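{- For every $\varepsilon_0\in[0,1/4)$ and integer $w\ge1$, on the $\mathrm{Tribes}$ instance of width $w$, the offline benchmark satisfies $\mathrm{opt}^{\mathrm{avg}}_0=O(2^w)$, while every $\varepsilon_0$-error online algorithm has expected cost $\Omega(2^w\cdot w)$ (the implied constant may depend on $\varepsilon_0$ but not on $w$).
   Context: The $\mathrm{Tribes}$ instance of width $w$: $n=2^w\cdot w$ variables $(x_{i,j})_{i\in[2^w],j\in[w]}$, function $f(x)=\bigvee_{i=1}^{2^w}\bigwedge_{j=1}^w x_{i,j}$, input $x$ uniform on $\{0,1\}^n$, and for each $i$ the costs $(c_{i,1},\dots,c_{i,w})$ form a uniformly random permutation of $[w]$, independently across $i$. Online priced query model: the algorithm knows $f$ but not $x$ or the costs; it maintains investments $\theta$ (initially $0$), each step increasing one coordinate by a positive amount; $x_{i,j}$ is revealed once $\theta_{i,j}\ge c_{i,j}$; cost is $\|\theta\|_1$ at halting. Offline algorithms know the costs and pay $c_{i,j}$ per revealed variable. An algorithm is $\varepsilon_0$-error if it outputs $f(x)$ except with probability at most $\varepsilon_0$; probabilities and expected costs are over the random input, costs, and algorithm's randomness; $\mathrm{opt}^{\mathrm{avg}}_0$ is the optimal expected cost of a zero-error offline algorithm.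
   Formalization: The error bound ε₀ is rational, and each step of an online algorithm increases one coordinate by a positive rational amount, where the English allows real ones. -}

module Defs where

open import Data.Bool using (Bool; true; false; _∧_; _∨_; if_then_else_)
import Data.Bool.Properties as Bool
open import Data.Fin using (Fin)
open import Data.Integer using (+_)
open import Data.List as List using (List; []; _∷_; length; filter; cartesianProduct; cartesianProductWith; applyUpTo)
open import Data.Maybe using (Maybe; just; nothing)
open import Data.Maybe.Properties using (≡-dec)
open import Data.Nat as ℕ using (ℕ; zero; suc)
open import Data.Product using (_×_; _,_; ∃-syntax)
open import Data.Rational using (ℚ; 0ℚ; 1ℚ; ½; _/_; _+_; _-_; _*_; _≤_; _<_)
open import Data.Rational.Properties using (_≤?_; +-0-commutativeMonoid)
open import Data.Vec as Vec using (Vec; []; _∷_; lookup)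
open import Data.Vec.Functional using (Vector; updateAt)
open import Data.Vec.Relation.Unary.AllPairs using (allPairs?)
open import Relation.Nullary.Decidable using (⌊_⌋; ¬?)
open import Algebra.Properties.CommutativeMonoid.Sum +-0-commutativeMonoid using (sum)

fromℕ : ℕ → ℚ
fromℕ n = + n / 1

-- The expectation of F under the uniform distribution on the entries of a
-- list (0 for the empty list).
uniform : ∀ {A : Set} → List A → (A → ℚ) → ℚ
uniform []       F = 0ℚ
uniform (x ∷ xs) F =
  List.foldr _+_ 0ℚ (List.map F (x ∷ xs)) * (+ 1 / suc (length xs))

tuples : ∀ {A : Set} → List A → (n : ℕ) → List (Vec A n)
tuples xs zero    = [] ∷ []
tuples xs (suc n) = cartesianProductWith _∷_ xs (tuples xs n)

-- The permutations of {1, …, w}, as the repetition-free w-tuples.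
permutations : (w : ℕ) → List (Vec ℕ w)
permutations w =
  filter (allPairs? λ a b → ¬? (a ℕ.≟ b)) (tuples (applyUpTo suc w) w)

Input : ℕ → Set
Input w = Vec (Vec Bool w) (2 ℕ.^ w)

Costs : ℕ → Set
Costs w = Vec (Vec ℕ w) (2 ℕ.^ w)

tribes : ∀ {w} → Input w → Bool
tribes x = Vec.foldr′ _∨_ false (Vec.map (Vec.foldr′ _∧_ true) x)

instances : (w : ℕ) → List (Input w × Costs w)
instances w = cartesianProduct
  (tuples (tuples (true ∷ false ∷ []) w) (2 ℕ.^ w))
  (tuples (permutations w) (2 ℕ.^ w))

entry : ∀ {A : Set} {m n} → Vec (Vec A n) m → Fin m → Fin n → A
entry v i j = lookup (lookup v i) j

-- Amounts paid so far, per variable.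
Payments : ℕ → Set
Payments w = Vector (Vector ℚ w) (2 ℕ.^ w)

modify : ∀ {w} → Payments w → Fin (2 ℕ.^ w) → Fin w → (ℚ → ℚ) → Payments w
modify θ i j g = updateAt θ i (λ row → updateAt row j g)

-- Payments are nonnegative throughout, so this is the ℓ₁ norm.
‖_‖₁ : ∀ {w} → Payments w → ℚ
‖ θ ‖₁ = sum (λ i → sum (θ i))

-- A randomized algorithm may toss any number of fair coins between its moves,
-- and it need not halt on every run.  Its next action depends on everything it
-- has observed; its own past moves are determined by these observations.
data Action (Move : Set) : Set where
  move : Move → Action Move
  flip : Action Move
  halt : Bool → Action Move

data Observation : Set where
  coin     : Bool → Observation
  response : Maybe Bool → Observation

-- Most recent observation first.
Strategy : Set → Set
Strategy Move = List Observation → Action Move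

-- The effect of a move on a fixed instance: the new payments, and the value
-- shown to the algorithm, if any.
Step : ℕ → Set → Set
Step w Move = Move → Payments w → Payments w × Maybe Bool

-- Expectation over the coins of g (payments) (output) after at most t actions;
-- the output is `nothing` if the algorithm has not halted by then.
run : ∀ {w Move} → Step w Move → Strategy Move →
      (Payments w → Maybe Bool → ℚ) →
      ℕ → List Observation → Payments w → ℚ
run step A g zero    h θ = g θ nothing
run step A g (suc t) h θ with A h
... | halt b = g θ (just b)
... | flip   = ½ * (run step A g t (coin true ∷ h) θ
                  + run step A g t (coin false ∷ h) θ)
... | move m with step m θ
...   | θ′ , r = run step A g t (response r ∷ h) θ′

record Investment (w : ℕ) : Set where
  constructor invest
  field
    tribe    : Fin (2 ℕ.^ w)
    member   : Fin w
    amount   : ℚ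
    positive : 0ℚ < amount

onlineStep : ∀ {w} → Input w → Costs w → Step w (Investment w)
onlineStep x c (invest i j δ _) θ =
  θ′ , (if ⌊ fromℕ (entry c i j) ≤? θ′ i j ⌋ then just (entry x i j) else nothing)
  where θ′ = modify θ i j (_+ δ)

OnlineAlgorithm : ℕ → Set
OnlineAlgorithm w = Strategy (Investment w)

record Query (w : ℕ) : Set where
  constructor query
  field
    tribe  : Fin (2 ℕ.^ w)
    member : Fin w

-- Each revealed variable is paid for once; repeating a query is free.
offlineStep : ∀ {w} → Input w → Costs w → Step w (Query w)
offlineStep x c (query i j) θ =
  modify θ i j (λ _ → fromℕ (entry c i j)) , just (entry x i j)

OfflineAlgorithm : ℕ → Set
OfflineAlgorithm w = Costs w → Strategy (Query w)

unpaid : ∀ {w} → Payments w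
unpaid _ _ = 0ℚ

-- Expectations over input, costs and coins, after at most t actions.
expectOnline : ∀ {w} → OnlineAlgorithm w →
               (Input w → Payments w → Maybe Bool → ℚ) → ℕ → ℚ
expectOnline {w} A g t = uniform (instances w) λ where
  (x , c) → run (onlineStep x c) A (g x) t [] unpaid

expectOffline : ∀ {w} → OfflineAlgorithm w →
                (Input w → Payments w → Maybe Bool → ℚ) → ℕ → ℚ
expectOffline {w} A g t = uniform (instances w) λ where
  (x , c) → run (offlineStep x c) (A c) (g x) t [] unpaid

totalCost : ∀ {w} → Input w → Payments w → Maybe Bool → ℚ
totalCost x θ out = ‖ θ ‖₁

correct : ∀ {w} → Input w → Payments w → Maybe Bool → ℚ
correct x θ out = if ⌊ ≡-dec Bool._≟_ out (just (tribes x)) ⌋ then 1ℚ else 0ℚ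

-- For fixed A, the expectations of `correct` and `totalCost` are nondecreasing
-- in t.  The success probability and the expected cost (possibly infinite) of
-- A are their suprema, which are handled through their comparisons with
-- rationals:  q ≤sup s  is  q ≤ sup s,  and  s sup≤ q  is  sup s ≤ q.
infix 4 _≤sup_ _sup≤_

_≤sup_ : ℚ → (ℕ → ℚ) → Set
q ≤sup s = ∀ q′ → q′ < q → ∃[ t ] q′ ≤ s t

_sup≤_ : (ℕ → ℚ) → ℚ → Set
s sup≤ q = ∀ t → s t ≤ q

OnlineError : ∀ {w} → ℚ → OnlineAlgorithm w → Set
OnlineError ε A = 1ℚ - ε ≤sup expectOnline A correct

OfflineError : ∀ {w} → ℚ → OfflineAlgorithm w → Set
OfflineError ε A = 1ℚ - ε ≤sup expectOffline A correct

-- opt≤ ε w B:  the infimum of the expected costs of the ε-error offline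
-- algorithms on the instance of width w is at most B.
opt≤ : ℚ → ℕ → ℚ → Set
opt≤ ε w B = ∀ B′ → B < B′ →
  ∃[ A ] (OfflineError {w} ε A × expectOffline A totalCost sup≤ B′)

{-# OPTIONS --safe #-}
module Submission where

-- Online.  At a fixed time, let τ be the expected fraction of touched tribes,
-- those in which some variable has been revealed.  Take a random input with
-- f = 0, let the algorithm answer 0, and pick a random tribe: unless it was
-- touched, the algorithm gives the same answer after that tribe is replaced by
-- a satisfied one.  Hence P(f = 1, answer 0) ≥ P(f = 0, answer 0) - τ, and the
-- success probability is at most P(f = 1) + τ ≤ 3/4 + τ.  So τ is bounded
-- below.  Touching a tribe is expensive: payments of total b reveal something
-- with probability at most b/w, and if a tribe is still untouched with
-- probability s, then the potential w s (1 - s)/2 is a lower bound for the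
-- expected value of payments minus w/2 times touching, whatever the algorithm
-- does next.  At the start s = 1, so the expected payments are at least w/2
-- times the probability of touching.
--
-- Offline.  In each tribe, query by increasing cost until a zero shows up.  The
-- expected further cost on reaching the variable of cost k satisfies
-- a(k) = k + a(k + 1)/2, so it is at most 2k + 2, that is, 4 per tribe.

open import Defs
import Algebra.Properties.CommutativeMonoid.Sum
open import Data.Bool using (Bool; true; false; _∧_; _∨_; if_then_else_; not)
import Data.Bool.Properties as Bool
open import Data.Empty using (⊥-elim)
open import Data.Fin as Fin using (Fin; zero; suc; toℕ)
import Data.Fin.Properties as Fin
open import Data.Integer as ℤ using (+_)
import Data.Integer.Properties as ℤ
open import Data.List as List using (List; []; _∷_; length; map; foldr; filter; applyUpTo; _++_; _∷ʳ_; cartesianProductWith)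
import Data.List.Properties as List
open import Data.List.Membership.Propositional using (_∈_)
open import Data.List.Membership.Propositional.Properties
open import Data.List.Relation.Unary.All as All using (All; []; _∷_)
open import Data.List.Relation.Unary.Any using (here; there)
open import Data.Maybe using (Maybe; just; nothing)
open import Data.Maybe.Properties using (≡-dec)
open import Data.Nat as ℕ using (ℕ; zero; suc; s≤s; z≤n)
import Data.Nat.Properties as ℕ
open import Data.Product using (_×_; _,_; proj₁; proj₂; ∃-syntax)
open import Data.Rational hiding (floor; positive)
open import Data.Rational.Properties
import Data.Rational.Unnormalised as ℚᵘ
import Data.Rational.Unnormalised.Properties as ℚᵘ
open import Data.Sum using (_⊎_; inj₁; inj₂)
open import Data.Unit using (⊤; tt)
open import Data.Vec as Vec using (Vec; []; _∷_; lookup)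
open import Data.Vec.Functional using (Vector; updateAt)
open import Data.Vec.Functional.Properties using (updateAt-updates; updateAt-minimal)
open import Data.Vec.Properties using (lookup∘updateAt; lookup∘updateAt′; lookup-map; lookup∘tabulate; map-∘; map-cong; map-id)
open import Data.Vec.Relation.Unary.AllPairs as AllPairs using (AllPairs; allPairs?)
import Data.Vec.Relation.Unary.AllPairs.Properties as AllPairs
import Data.Vec.Relation.Unary.Unique.Propositional.Properties as Unique
open import Function using (_∘_; id)
open import Level using (0ℓ)
open import Relation.Binary.PropositionalEquality
open import Relation.Nullary using (Dec; yes; no; ¬_; ¬?)
open import Relation.Nullary.Decidable using (⌊_⌋; dec⇒maybe)
open import Relation.Unary using (Pred; Decidable)
open import Tactic.RingSolver using (solve-∀)
open import Tactic.RingSolver.Core.AlmostCommutativeRing using (AlmostCommutativeRing; fromCommutativeRing)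
open Algebra.Properties.CommutativeMonoid.Sum +-0-commutativeMonoid using (sum; sum-cong-≗; ∑-distrib-+)

-- The difficulty is adaptivity: what is paid into one tribe may depend on the coins and on
-- everything seen in the other tribes. Each tribe is therefore treated with the input and the other
-- cost rows held fixed, and the average is over its own cost row alone. After the same coins, all
-- cost rows under which the tribe is still untouched have produced the same observations, so one
-- history serves them all. They are weighted by 0 or 1 instead of being conditioned on, which
-- avoids dividing by the probability s. The replacement of a tribe works because the number 2^w of
-- tribes is exactly the reciprocal of the probability that a tribe is satisfied: satisfying one
-- chosen tribe costs a factor 2^-w, and the 2^w choices lead to disjoint events, which together
-- restore it. Everything online happens at one fixed time, where each expectation is a finite
-- average. Suprema enter only at the very end, at the price of half of the gap 1/4 - ε₀.

ℚ-ring : AlmostCommutativeRing 0ℓ 0ℓ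
ℚ-ring = fromCommutativeRing +-*-commutativeRing λ p → dec⇒maybe (0ℚ ≟ p)

-- Order and arithmetic of the rationals

≤-by : ∀ {p q} d → 0ℚ ≤ d → p + d ≡ q → p ≤ q
≤-by {p} d 0≤d p+d≡q = begin
  p       ≡⟨ +-identityʳ p ⟨
  p + 0ℚ  ≤⟨ +-monoʳ-≤ p 0≤d ⟩
  p + d   ≡⟨ p+d≡q ⟩
  _       ∎
  where open ≤-Reasoning

p≤q⇒0≤q-p : ∀ {p q} → p ≤ q → 0ℚ ≤ q - p
p≤q⇒0≤q-p {p} {q} p≤q = subst (_≤ q - p) (+-inverseʳ p) (+-monoˡ-≤ (- p) p≤q)

p<q⇒0<q-p : ∀ {p q} → p < q → 0ℚ < q - p
p<q⇒0<q-p {p} {q} p<q = subst (_< q - p) (+-inverseʳ p) (+-monoˡ-< (- p) p<q)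

0≤+ : ∀ {p q} → 0ℚ ≤ p → 0ℚ ≤ q → 0ℚ ≤ p + q
0≤+ = +-mono-≤

*-monoˡ-≤ : ∀ {p q r} → 0ℚ ≤ r → p ≤ q → r * p ≤ r * q
*-monoˡ-≤ {r = r} 0≤r = *-monoˡ-≤-nonNeg r {{nonNegative 0≤r}}

*-monoʳ-≤ : ∀ {p q r} → 0ℚ ≤ r → p ≤ q → p * r ≤ q * r
*-monoʳ-≤ {r = r} 0≤r = *-monoʳ-≤-nonNeg r {{nonNegative 0≤r}}

0≤* : ∀ {p q} → 0ℚ ≤ p → 0ℚ ≤ q → 0ℚ ≤ p * q
0≤* {p} 0≤p 0≤q = subst (_≤ p * _) (*-zeroʳ p) (*-monoˡ-≤ 0≤p 0≤q)

+-congˡ : ∀ p {q r} → q ≡ r → p + q ≡ p + r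
+-congˡ p = cong (λ q → p + q)

0≤1 : 0ℚ ≤ 1ℚ
0≤1 = nonNegative⁻¹ 1ℚ

0≤½ : 0ℚ ≤ ½
0≤½ = nonNegative⁻¹ ½

-- With 1/0 = 0, uniform-Σ also covers the empty list.
recip : ℕ → ℚ
recip zero    = 0ℚ
recip (suc n) = + 1 / suc n

0≤recip : ∀ n → 0ℚ ≤ recip n
0≤recip zero    = ≤-refl
0≤recip (suc n) = nonNegative⁻¹ (+ 1 / suc n) {{normalize-nonNeg 1 (suc n)}}

-- Since `_/_` divides by a gcd that does not compute on variables, the identity is transported to
-- unnormalised rationals, where it is plain multiplication of numerators and denominators.
/-*-/ : ∀ i j m n → (i / suc m) * (j / suc n) ≡ (i ℤ.* j) / (suc m ℕ.* suc n)
/-*-/ i j m n = toℚᵘ-injective (begin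
  toℚᵘ ((i / suc m) * (j / suc n))                   ≈⟨ toℚᵘ-homo-* (i / suc m) (j / suc n) ⟩
  toℚᵘ (i / suc m) ℚᵘ.* toℚᵘ (j / suc n)             ≈⟨ ℚᵘ.*-cong (toℚᵘ-fromℚᵘ (ℚᵘ.mkℚᵘ i m)) (toℚᵘ-fromℚᵘ (ℚᵘ.mkℚᵘ j n)) ⟩
  ℚᵘ.mkℚᵘ i m ℚᵘ.* ℚᵘ.mkℚᵘ j n                       ≈⟨ toℚᵘ-fromℚᵘ (ℚᵘ.mkℚᵘ i m ℚᵘ.* ℚᵘ.mkℚᵘ j n) ⟨
  toℚᵘ ((i ℤ.* j) / (suc m ℕ.* suc n))               ∎)
  where open ℚᵘ.≃-Reasoning

/-+-/1 : ∀ i j → (i / 1) + (j / 1) ≡ (i ℤ.+ j) / 1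
/-+-/1 i j = toℚᵘ-injective (begin
  toℚᵘ ((i / 1) + (j / 1))           ≈⟨ toℚᵘ-homo-+ (i / 1) (j / 1) ⟩
  toℚᵘ (i / 1) ℚᵘ.+ toℚᵘ (j / 1)     ≈⟨ ℚᵘ.+-cong (toℚᵘ-fromℚᵘ (ℚᵘ.mkℚᵘ i 0)) (toℚᵘ-fromℚᵘ (ℚᵘ.mkℚᵘ j 0)) ⟩
  ℚᵘ.mkℚᵘ i 0 ℚᵘ.+ ℚᵘ.mkℚᵘ j 0       ≡⟨ cong (λ k → ℚᵘ.mkℚᵘ k 0) (cong₂ ℤ._+_ (ℤ.*-identityʳ i) (ℤ.*-identityʳ j)) ⟩
  ℚᵘ.mkℚᵘ (i ℤ.+ j) 0                ≈⟨ toℚᵘ-fromℚᵘ (ℚᵘ.mkℚᵘ (i ℤ.+ j) 0) ⟨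
  toℚᵘ ((i ℤ.+ j) / 1)               ∎)
  where open ℚᵘ.≃-Reasoning

fromℕ-+ : ∀ m n → fromℕ (m ℕ.+ n) ≡ fromℕ m + fromℕ n
fromℕ-+ m n = sym (/-+-/1 (+ m) (+ n))

fromℕ-suc : ∀ n → fromℕ (suc n) ≡ 1ℚ + fromℕ n
fromℕ-suc = fromℕ-+ 1

fromℕ-* : ∀ m n → fromℕ (m ℕ.* n) ≡ fromℕ m * fromℕ n
fromℕ-* m n = sym (trans (/-*-/ (+ m) (+ n) 0 0) (cong (_/ 1) (sym (ℤ.pos-* m n))))

0≤fromℕ : ∀ n → 0ℚ ≤ fromℕ n
0≤fromℕ n = nonNegative⁻¹ (fromℕ n) {{normalize-nonNeg n 1}}

recip-* : ∀ m n → recip (m ℕ.* n) ≡ recip m * recip n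
recip-* zero    n       = sym (*-zeroˡ (recip n))
recip-* (suc m) zero    rewrite ℕ.*-zeroʳ m = sym (*-zeroʳ (recip (suc m)))
recip-* (suc m) (suc n) = sym (/-*-/ (+ 1) (+ 1) m n)

fromℕ*recip : ∀ n → fromℕ (suc n) * recip (suc n) ≡ 1ℚ
fromℕ*recip n = trans (/-*-/ (+ suc n) (+ 1) 0 n)
  (fromℚᵘ-cong {ℚᵘ.mkℚᵘ (+ suc n ℤ.* + 1) (n ℕ.+ 0)} {ℚᵘ.mkℚᵘ (+ 1) 0} (ℚᵘ.*≡* eq))
  where
  eq : (+ suc n ℤ.* + 1) ℤ.* + 1 ≡ + 1 ℤ.* + suc (n ℕ.+ 0)
  eq = trans (ℤ.*-identityʳ _) (trans (ℤ.*-identityʳ (+ suc n))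
    (trans (cong (λ k → + suc k) (sym (ℕ.+-identityʳ n))) (sym (ℤ.*-identityˡ _))))
  
-- Sums over finite types

sum-mono : ∀ {n} {f g : Fin n → ℚ} → (∀ i → f i ≤ g i) → sum f ≤ sum g
sum-mono {zero}  f≤g = ≤-refl
sum-mono {suc n} f≤g = +-mono-≤ (f≤g zero) (sum-mono (f≤g ∘ suc))

sum-*ˡ : ∀ {n} k (f : Fin n → ℚ) → sum (λ i → k * f i) ≡ k * sum f
sum-*ˡ {zero}  k f = sym (*-zeroʳ k)
sum-*ˡ {suc n} k f = trans (+-congˡ (k * f zero) (sum-*ˡ k (f ∘ suc))) (sym (*-distribˡ-+ k (f zero) (sum (f ∘ suc))))

sum-const : ∀ n k → sum {n} (λ _ → k) ≡ fromℕ n * k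
sum-const zero    k = sym (*-zeroˡ k)
sum-const (suc n) k = trans (+-congˡ k (sum-const n k))
  (trans (lemma k (fromℕ n)) (cong (_* k) (sym (fromℕ-suc n))))
  where
  lemma : ∀ k m → k + m * k ≡ (1ℚ + m) * k
  lemma = solve-∀ ℚ-ring

-- Sums over lists

-- Shaped like the numerator in `uniform`, so that `uniform-Σ` holds by computation.
Σ : {A : Set} → List A → (A → ℚ) → ℚ
Σ xs F = foldr _+_ 0ℚ (map F xs)

module _ {A : Set} where

  Σ-mono : ∀ (xs : List A) {F G} → (∀ x → x ∈ xs → F x ≤ G x) → Σ xs F ≤ Σ xs G
  Σ-mono []       F≤G = ≤-refl
  Σ-mono (x ∷ xs) F≤G = +-mono-≤ (F≤G x (here refl)) (Σ-mono xs λ y → F≤G y ∘ there)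

  Σ-cong : ∀ (xs : List A) {F G} → (∀ x → F x ≡ G x) → Σ xs F ≡ Σ xs G
  Σ-cong xs F≡G = cong (foldr _+_ 0ℚ) (List.map-cong F≡G xs)

  Σ-+ : ∀ (xs : List A) F G → Σ xs (λ x → F x + G x) ≡ Σ xs F + Σ xs G
  Σ-+ []       F G = refl
  Σ-+ (x ∷ xs) F G = trans (+-congˡ (F x + G x) (Σ-+ xs F G)) (lemma (F x) (G x) (Σ xs F) (Σ xs G))
    where
    lemma : ∀ a b c d → (a + b) + (c + d) ≡ (a + c) + (b + d)
    lemma = solve-∀ ℚ-ring

  Σ-*ˡ : ∀ (xs : List A) k F → Σ xs (λ x → k * F x) ≡ k * Σ xs F
  Σ-*ˡ []       k F = sym (*-zeroʳ k)
  Σ-*ˡ (x ∷ xs) k F = trans (+-congˡ (k * F x) (Σ-*ˡ xs k F)) (sym (*-distribˡ-+ k (F x) (Σ xs F)))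

  Σ-const : ∀ (xs : List A) k → Σ xs (λ _ → k) ≡ fromℕ (length xs) * k
  Σ-const []       k = sym (*-zeroˡ k)
  Σ-const (x ∷ xs) k = trans (+-congˡ k (Σ-const xs k))
    (trans (lemma k (fromℕ (length xs))) (cong (_* k) (sym (fromℕ-suc (length xs)))))
    where
    lemma : ∀ k m → k + m * k ≡ (1ℚ + m) * k
    lemma = solve-∀ ℚ-ring

  Σ-++ : ∀ (xs ys : List A) F → Σ (xs ++ ys) F ≡ Σ xs F + Σ ys F
  Σ-++ []       ys F = sym (+-identityˡ (Σ ys F))
  Σ-++ (x ∷ xs) ys F = trans (+-congˡ (F x) (Σ-++ xs ys F)) (sym (+-assoc (F x) (Σ xs F) (Σ ys F)))

Σ-map : ∀ {A B : Set} (f : A → B) xs F → Σ (map f xs) F ≡ Σ xs (F ∘ f)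
Σ-map f xs F = cong (foldr _+_ 0ℚ) (sym (List.map-∘ xs))

Σ-cartesianProductWith : ∀ {A B C : Set} (f : A → B → C) xs ys F →
  Σ (cartesianProductWith f xs ys) F ≡ Σ xs λ x → Σ ys λ y → F (f x y)
Σ-cartesianProductWith f []       ys F = refl
Σ-cartesianProductWith f (x ∷ xs) ys F = trans
  (Σ-++ (map (f x) ys) (cartesianProductWith f xs ys) F)
  (cong₂ _+_ (Σ-map (f x) ys F) (Σ-cartesianProductWith f xs ys F))

Σ-swap : ∀ {A B : Set} (xs : List A) (ys : List B) (F : A → B → ℚ) →
  Σ xs (λ x → Σ ys (F x)) ≡ Σ ys (λ y → Σ xs λ x → F x y)
Σ-swap []       ys F = sym (trans (Σ-const ys 0ℚ) (*-zeroʳ (fromℕ (length ys))))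
Σ-swap (x ∷ xs) ys F = trans (+-congˡ (Σ ys (F x)) (Σ-swap xs ys F)) (sym (Σ-+ ys (F x) λ y → Σ xs λ x → F x y))

-- Uniform averages

module _ {A : Set} where

  uniform-Σ : ∀ (xs : List A) F → uniform xs F ≡ Σ xs F * recip (length xs)
  uniform-Σ []       F = refl
  uniform-Σ (x ∷ xs) F = refl

  uniform-mono : ∀ (xs : List A) {F G} → (∀ x → x ∈ xs → F x ≤ G x) → uniform xs F ≤ uniform xs G
  uniform-mono xs {F} {G} F≤G = subst₂ _≤_ (sym (uniform-Σ xs F)) (sym (uniform-Σ xs G))
    (*-monoʳ-≤ (0≤recip (length xs)) (Σ-mono xs F≤G))

  uniform-cong : ∀ (xs : List A) {F G} → (∀ x → F x ≡ G x) → uniform xs F ≡ uniform xs G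
  uniform-cong xs F≡G = ≤-antisym (uniform-mono xs λ x _ → ≤-reflexive (F≡G x))
    (uniform-mono xs λ x _ → ≤-reflexive (sym (F≡G x)))

  uniform-+ : ∀ (xs : List A) F G → uniform xs (λ x → F x + G x) ≡ uniform xs F + uniform xs G
  uniform-+ xs F G rewrite uniform-Σ xs F | uniform-Σ xs G | uniform-Σ xs (λ x → F x + G x) | Σ-+ xs F G =
    *-distribʳ-+ (recip (length xs)) (Σ xs F) (Σ xs G)

  uniform-*ˡ : ∀ (xs : List A) k F → uniform xs (λ x → k * F x) ≡ k * uniform xs F
  uniform-*ˡ xs k F rewrite uniform-Σ xs F | uniform-Σ xs (λ x → k * F x) | Σ-*ˡ xs k F =
    *-assoc k (Σ xs F) (recip (length xs))

  uniform-*ʳ : ∀ (xs : List A) F k → uniform xs (λ x → F x * k) ≡ uniform xs F * k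
  uniform-*ʳ xs F k = trans (uniform-cong xs λ x → *-comm (F x) k) (trans (uniform-*ˡ xs k F) (*-comm k (uniform xs F)))

  -- `uniform` is 0 on the empty list, so constants are preserved only on nonempty lists. Here and
  -- below a member of the list witnesses that it is nonempty.
  uniform-const : ∀ {xs : List A} {x} → x ∈ xs → ∀ k → uniform xs (λ _ → k) ≡ k
  uniform-const {xs@(_ ∷ ys)} _ k = begin
    Σ xs (λ _ → k) * recip (length xs)              ≡⟨ cong (_* recip (length xs)) (Σ-const xs k) ⟩
    fromℕ (length xs) * k * recip (length xs)       ≡⟨ lemma (fromℕ (length xs)) k (recip (length xs)) ⟩
    k * (fromℕ (length xs) * recip (length xs))     ≡⟨ cong (k *_) (fromℕ*recip (length ys)) ⟩
    k * 1ℚ                                          ≡⟨ *-identityʳ k ⟩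
    k                                               ∎
    where
    open ≡-Reasoning
    lemma : ∀ a b c → a * b * c ≡ b * (a * c)
    lemma = solve-∀ ℚ-ring

  uniform-0 : ∀ (xs : List A) → uniform xs (λ _ → 0ℚ) ≡ 0ℚ
  uniform-0 []           = refl
  uniform-0 xs@(x ∷ _)   = uniform-const {xs} (here refl) 0ℚ

  uniform-≤-const : ∀ {xs : List A} {y} → y ∈ xs → ∀ {F k} → (∀ x → x ∈ xs → F x ≤ k) → uniform xs F ≤ k
  uniform-≤-const {xs} y∈xs {F} {k} F≤k = subst (uniform xs F ≤_) (uniform-const y∈xs k) (uniform-mono xs F≤k)

  const-≤-uniform : ∀ {xs : List A} {y} → y ∈ xs → ∀ {F k} → (∀ x → x ∈ xs → k ≤ F x) → k ≤ uniform xs F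
  const-≤-uniform {xs} y∈xs {F} {k} k≤F = subst (_≤ uniform xs F) (uniform-const y∈xs k) (uniform-mono xs k≤F)

  0≤uniform : ∀ (xs : List A) {F} → (∀ x → x ∈ xs → 0ℚ ≤ F x) → 0ℚ ≤ uniform xs F
  0≤uniform xs {F} 0≤F = subst (_≤ uniform xs F) (uniform-0 xs) (uniform-mono xs 0≤F)

  uniform-sum : ∀ {n} (xs : List A) (F : A → Fin n → ℚ) →
    uniform xs (λ x → sum (F x)) ≡ sum (λ i → uniform xs (λ x → F x i))
  uniform-sum {zero}  xs F = uniform-0 xs
  uniform-sum {suc n} xs F = trans (uniform-+ xs (λ x → F x zero) (λ x → sum (F x ∘ suc)))
    (+-congˡ (uniform xs λ x → F x zero) (uniform-sum xs λ x → F x ∘ suc))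

uniform-swap : ∀ {A B : Set} (xs : List A) (ys : List B) (F : A → B → ℚ) →
  uniform xs (λ x → uniform ys (F x)) ≡ uniform ys (λ y → uniform xs λ x → F x y)
uniform-swap xs ys F = begin
  uniform xs (λ x → uniform ys (F x))                       ≡⟨ unfold xs ys F ⟩
  Σ xs (λ x → Σ ys (F x)) * (recip (length ys) * recip (length xs))
                                                            ≡⟨ cong₂ _*_ (Σ-swap xs ys F) (*-comm (recip (length ys)) (recip (length xs))) ⟩
  Σ ys (λ y → Σ xs λ x → F x y) * (recip (length xs) * recip (length ys))
                                                            ≡⟨ unfold ys xs (λ y x → F x y) ⟨
  uniform ys (λ y → uniform xs λ x → F x y)                 ∎
  where
  open ≡-Reasoning
  unfold : ∀ {A B : Set} (xs : List A) (ys : List B) (F : A → B → ℚ) → uniform xs (λ x → uniform ys (F x)) ≡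
    Σ xs (λ x → Σ ys (F x)) * (recip (length ys) * recip (length xs))
  unfold {A} xs ys F = begin
    uniform xs (λ x → uniform ys (F x))      ≡⟨ uniform-cong xs (λ x → uniform-Σ ys (F x)) ⟩
    uniform xs (λ x → S x * n)               ≡⟨ uniform-*ʳ xs S n ⟩
    uniform xs S * n                         ≡⟨ cong (_* n) (uniform-Σ xs S) ⟩
    Σ xs S * m * n                           ≡⟨ lemma (Σ xs S) m n ⟩
    Σ xs S * (n * m)                         ∎
    where
    m = recip (length xs)
    n = recip (length ys)
    S : A → ℚ
    S x = Σ ys (F x)
    lemma : ∀ a b c → a * b * c ≡ a * (c * b)
    lemma = solve-∀ ℚ-ring

uniform-cartesianProductWith : ∀ {A B C : Set} (f : A → B → C) xs ys (F : C → ℚ) →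
  uniform (cartesianProductWith f xs ys) F ≡ uniform xs λ x → uniform ys λ y → F (f x y)
uniform-cartesianProductWith f xs ys F = begin
  uniform (cartesianProductWith f xs ys) F
    ≡⟨ uniform-Σ (cartesianProductWith f xs ys) F ⟩
  Σ (cartesianProductWith f xs ys) F * recip (length (cartesianProductWith f xs ys))
    ≡⟨ cong₂ (λ s l → s * recip l) (Σ-cartesianProductWith f xs ys F) (length-cartesianProductWith xs) ⟩
  Σ xs S * recip (length xs ℕ.* length ys)
    ≡⟨ cong (Σ xs S *_) (recip-* (length xs) (length ys)) ⟩
  Σ xs S * (recip (length xs) * recip (length ys))
    ≡⟨ *-assoc (Σ xs S) (recip (length xs)) (recip (length ys)) ⟨
  Σ xs S * recip (length xs) * recip (length ys)
    ≡⟨ cong (_* recip (length ys)) (uniform-Σ xs S) ⟨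
  uniform xs S * recip (length ys)
    ≡⟨ uniform-*ʳ xs S (recip (length ys)) ⟨
  uniform xs (λ x → S x * recip (length ys))
    ≡⟨ uniform-cong xs (λ x → uniform-Σ ys (λ y → F (f x y))) ⟨
  uniform xs (λ x → uniform ys λ y → F (f x y)) ∎
  where
  open ≡-Reasoning
  S = λ x → Σ ys λ y → F (f x y)
  length-cartesianProductWith : ∀ xs → length (cartesianProductWith f xs ys) ≡ length xs ℕ.* length ys
  length-cartesianProductWith []       = refl
  length-cartesianProductWith (x ∷ xs) = trans (List.length-++ (map (f x) ys))
    (cong₂ ℕ._+_ (List.length-map (f x) ys) (length-cartesianProductWith xs))

-- Random vectors with independent coordinates

module _ {A : Set} (X : List A) where

  uniform-tuples-suc : ∀ n F →
    uniform (tuples X (suc n)) F ≡ uniform X λ a → uniform (tuples X n) λ v → F (a ∷ v)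
  uniform-tuples-suc n = uniform-cartesianProductWith _∷_ X (tuples X n)

  uniform-tuples-zero : ∀ F → uniform (tuples X 0) F ≡ F []
  uniform-tuples-zero F = trans (*-identityʳ (F [] + 0ℚ)) (+-identityʳ (F []))

  replicate-∈ : ∀ {a} → a ∈ X → ∀ n → Vec.replicate n a ∈ tuples X n
  replicate-∈ a∈X zero    = here refl
  replicate-∈ a∈X (suc n) = ∈-cartesianProductWith⁺ _∷_ a∈X (replicate-∈ a∈X n)

  tuples-lookup : ∀ n {v} → v ∈ tuples X n → ∀ i → lookup v i ∈ X
  tuples-lookup (suc n) v∈ i with ∈-cartesianProductWith⁻ _∷_ X (tuples X n) v∈
  tuples-lookup (suc n) _ zero    | a , v , a∈ , v∈ , refl = a∈
  tuples-lookup (suc n) _ (suc i) | a , v , a∈ , v∈ , refl = tuples-lookup n v∈ i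

  lookup-tuples : ∀ {n} (v : Vec A n) → (∀ i → lookup v i ∈ X) → v ∈ tuples X n
  lookup-tuples []      _  = here refl
  lookup-tuples (a ∷ v) ∈X = ∈-cartesianProductWith⁺ _∷_ (∈X zero) (lookup-tuples v (∈X ∘ suc))

  module _ {a} (a∈X : a ∈ X) where

    -- The coordinates are independent, so a fresh draw in one of them changes nothing on average.
    -- This is the substitute for conditioning on all other coordinates: it isolates an input row in
    -- `disguise`, a cost row in `touching-cost` and a single bit in `fair-bit`.
    resample : ∀ {n} i F →
      uniform (tuples X n) F ≡ uniform (tuples X n) λ v → uniform X λ r → F (v Vec.[ i ]≔ r)
    resample {suc n} zero F = begin
      uniform (tuples X (suc n)) F
        ≡⟨ uniform-tuples-suc n F ⟩
      uniform X (λ r → uniform (tuples X n) λ v → F (r ∷ v))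
        ≡⟨ uniform-swap X (tuples X n) (λ r v → F (r ∷ v)) ⟩
      uniform (tuples X n) (λ v → uniform X λ r → F (r ∷ v))
        ≡⟨ uniform-const a∈X (uniform (tuples X n) λ v → uniform X λ r → F (r ∷ v)) ⟨
      uniform X (λ _ → uniform (tuples X n) λ v → uniform X λ r → F (r ∷ v))
        ≡⟨ uniform-tuples-suc n (λ v → uniform X λ r → F (v Vec.[ zero ]≔ r)) ⟨
      uniform (tuples X (suc n)) (λ v → uniform X λ r → F (v Vec.[ zero ]≔ r)) ∎
      where open ≡-Reasoning
    resample {suc n} (suc i) F = begin
      uniform (tuples X (suc n)) F
        ≡⟨ uniform-tuples-suc n F ⟩
      uniform X (λ b → uniform (tuples X n) λ v → F (b ∷ v))
        ≡⟨ uniform-cong X (λ b → resample i (λ v → F (b ∷ v))) ⟩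
      uniform X (λ b → uniform (tuples X n) λ v → uniform X λ r → F (b ∷ v Vec.[ i ]≔ r))
        ≡⟨ uniform-tuples-suc n (λ v → uniform X λ r → F (v Vec.[ suc i ]≔ r)) ⟨
      uniform (tuples X (suc n)) (λ v → uniform X λ r → F (v Vec.[ suc i ]≔ r)) ∎
      where open ≡-Reasoning

    uniform-lookup : ∀ {n} i F → uniform (tuples X n) (λ v → F (lookup v i)) ≡ uniform X F
    uniform-lookup {n} i F = begin
      uniform (tuples X n) (λ v → F (lookup v i))
        ≡⟨ resample i (λ v → F (lookup v i)) ⟩
      uniform (tuples X n) (λ v → uniform X λ r → F (lookup (v Vec.[ i ]≔ r) i))
        ≡⟨ uniform-cong (tuples X n) (λ v → uniform-cong X λ r → cong F (lookup∘updateAt i v)) ⟩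
      uniform (tuples X n) (λ _ → uniform X F)
        ≡⟨ uniform-const (replicate-∈ a∈X n) (uniform X F) ⟩
      uniform X F ∎
      where
      open ≡-Reasoning

-- Indicators of decidable propositions

indicator : {P : Set} → Dec P → ℚ
indicator P? = if ⌊ P? ⌋ then 1ℚ else 0ℚ

module _ {P : Set} where

  indicator-yes : (P? : Dec P) → P → indicator P? ≡ 1ℚ
  indicator-yes (yes _) _ = refl
  indicator-yes (no ¬p) p = ⊥-elim (¬p p)

  indicator-no : (P? : Dec P) → ¬ P → indicator P? ≡ 0ℚ
  indicator-no (yes p) ¬p = ⊥-elim (¬p p)
  indicator-no (no _)  _  = refl

  0≤indicator : (P? : Dec P) → 0ℚ ≤ indicator P?
  0≤indicator (yes _) = 0≤1
  0≤indicator (no _)  = ≤-refl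

  indicator≤1 : (P? : Dec P) → indicator P? ≤ 1ℚ
  indicator≤1 (yes _) = ≤-refl
  indicator≤1 (no _)  = 0≤1

  if-no : ∀ {A : Set} {a b : A} (P? : Dec P) → ¬ P → (if ⌊ P? ⌋ then a else b) ≡ b
  if-no (yes p) ¬p = ⊥-elim (¬p p)
  if-no (no _)  _  = refl

indicator-mono : ∀ {P Q : Set} (P? : Dec P) (Q? : Dec Q) → (P → Q) → indicator P? ≤ indicator Q?
indicator-mono (yes p) Q? P⇒Q = ≤-reflexive (sym (indicator-yes Q? (P⇒Q p)))
indicator-mono (no _)  Q? _   = 0≤indicator Q?

-- Runs of an algorithm

module _ {w : ℕ} {Move : Set} (step : Step w Move) (A : Strategy Move) where

  -- `Inv` records what is known about reachable payments, so that the two final values need to be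
  -- compared only there.
  run-mono : (Inv : Payments w → Set) → (∀ m θ → Inv θ → Inv (proj₁ (step m θ))) →
    ∀ {g g′} → (∀ θ o → Inv θ → g θ o ≤ g′ θ o) →
    ∀ t h θ → Inv θ → run step A g t h θ ≤ run step A g′ t h θ
  run-mono Inv pres g≤g′ zero    h θ inv = g≤g′ θ nothing inv
  run-mono Inv pres g≤g′ (suc t) h θ inv with A h
  ... | halt b = g≤g′ θ (just b) inv
  ... | flip   = *-monoˡ-≤ 0≤½ (+-mono-≤ (run-mono Inv pres g≤g′ t _ θ inv) (run-mono Inv pres g≤g′ t _ θ inv))
  ... | move m with step m θ | pres m θ inv
  ...   | θ′ , r | inv′ = run-mono Inv pres g≤g′ t (response r ∷ h) θ′ inv′

  run-const : ∀ k t h θ → run step A (λ _ _ → k) t h θ ≡ k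
  run-const k zero    h θ = refl
  run-const k (suc t) h θ with A h
  ... | halt b = refl
  ... | flip rewrite run-const k t (coin true ∷ h) θ | run-const k t (coin false ∷ h) θ = lemma k
    where
    lemma : ∀ k → ½ * (k + k) ≡ k
    lemma = solve-∀ ℚ-ring
  ... | move m with step m θ
  ...   | θ′ , r = run-const k t (response r ∷ h) θ′

  run-+ : ∀ g g′ t h θ →
    run step A (λ θ o → g θ o + g′ θ o) t h θ ≡ run step A g t h θ + run step A g′ t h θ
  run-+ g g′ zero    h θ = refl
  run-+ g g′ (suc t) h θ with A h
  ... | halt b = refl
  ... | flip rewrite run-+ g g′ t (coin true ∷ h) θ | run-+ g g′ t (coin false ∷ h) θ =
    lemma (run step A g t (coin true ∷ h) θ) (run step A g t (coin false ∷ h) θ)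
          (run step A g′ t (coin true ∷ h) θ) (run step A g′ t (coin false ∷ h) θ)
    where
    lemma : ∀ a b c d → ½ * (a + c + (b + d)) ≡ ½ * (a + b) + ½ * (c + d)
    lemma = solve-∀ ℚ-ring
  ... | move m with step m θ
  ...   | θ′ , r = run-+ g g′ t (response r ∷ h) θ′

  run-*ˡ : ∀ k g t h θ → run step A (λ θ o → k * g θ o) t h θ ≡ k * run step A g t h θ
  run-*ˡ k g zero    h θ = refl
  run-*ˡ k g (suc t) h θ with A h
  ... | halt b = refl
  ... | flip rewrite run-*ˡ k g t (coin true ∷ h) θ | run-*ˡ k g t (coin false ∷ h) θ =
    lemma k (run step A g t (coin true ∷ h) θ) (run step A g t (coin false ∷ h) θ)
    where
    lemma : ∀ k a b → ½ * (k * a + k * b) ≡ k * (½ * (a + b))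
    lemma = solve-∀ ℚ-ring
  ... | move m with step m θ
  ...   | θ′ , r = run-*ˡ k g t (response r ∷ h) θ′

  run-sum : ∀ {n} (g : Fin n → Payments w → Maybe Bool → ℚ) t h θ →
    run step A (λ θ o → sum (λ i → g i θ o)) t h θ ≡ sum (λ i → run step A (g i) t h θ)
  run-sum {zero}  g t h θ = run-const 0ℚ t h θ
  run-sum {suc n} g t h θ =
    trans (run-+ (g zero) (λ θ o → sum (λ i → g (suc i) θ o)) t h θ)
          (+-congˡ (run step A (g zero) t h θ) (run-sum (g ∘ suc) t h θ))

module _ {w : ℕ} {Move : Set} (step : Step w Move) (A : Strategy Move) {g g′ : Payments w → Maybe Bool → ℚ} where

  run-≤ : (∀ θ o → g θ o ≤ g′ θ o) → ∀ t h θ → run step A g t h θ ≤ run step A g′ t h θ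
  run-≤ g≤g′ t h θ = run-mono step A (λ _ → ⊤) (λ _ _ _ → tt) (λ θ o _ → g≤g′ θ o) t h θ tt

module _ {w : ℕ} {Move : Set} (step step′ : Step w Move) (A : Strategy Move) {g : Payments w → Maybe Bool → ℚ}
  (Dead : Payments w → Set)
  (agree : ∀ m θ → Dead (proj₁ (step m θ)) × Dead (proj₁ (step′ m θ)) ⊎ step m θ ≡ step′ m θ)
  (dead : ∀ t h θ → Dead θ → run step A g t h θ ≡ 0ℚ)
  (dead′ : ∀ t h θ → Dead θ → run step′ A g t h θ ≡ 0ℚ)
  where

  -- A coupling: as long as the steps agree, both runs have the same history and hence make the same
  -- moves. When they part, both are in `Dead`, from where both contribute 0.
  run-agree : ∀ t h θ → run step A g t h θ ≡ run step′ A g t h θ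
  run-agree zero    h θ = refl
  run-agree (suc t) h θ with A h
  ... | halt b = refl
  ... | flip   = cong (½ *_) (cong₂ _+_ (run-agree t (coin true ∷ h) θ) (run-agree t (coin false ∷ h) θ))
  ... | move m with step m θ | step′ m θ | agree m θ
  ...   | θ₁ , r | θ₂ , r′ | inj₁ (d , d′)  = trans (dead t _ _ d) (sym (dead′ t _ _ d′))
  ...   | θ₁ , r | _       | inj₂ refl      = run-agree t (response r ∷ h) θ₁

-- In the hypothesis `moving`, V r o is the value of the run on r if the answer is o.
module _ {B : Set} {w : ℕ} {Move : Set} (A : Strategy Move) (R : List B)
  (next : Move → Payments w → Payments w) (answer : B → Move → Payments w → Maybe Bool)
  (g : B → Payments w → ℚ) (u : B → Payments w → ℚ) (Ψ : Payments w → ℚ) (Inv : Payments w → Set)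
  where

  private
    step : B → Step w Move
    step r m θ = next m θ , answer r m θ

    value : B → ℕ → List Observation → Payments w → ℚ
    value r = run (step r) A (λ θ _ → g r θ)

  module _
    (preserved : ∀ m θ → Inv θ → Inv (next m θ))
    (floor : Payments w → ℚ)
    (value≥floor : ∀ r t h θ → floor θ ≤ value r t h θ)
    (stopping : ∀ θ → Inv θ → Ψ θ ≤ uniform R λ r → u r θ * g r θ)
    (moving : ∀ m θ → Inv θ → (V : B → Maybe Bool → ℚ) →
      (∀ o → Ψ (next m θ) ≤ uniform R λ r → u r (next m θ) * V r o) →
      (∀ r o → floor (next m θ) ≤ V r o) →
      Ψ θ ≤ uniform R λ r → u r θ * V r (answer r m θ))
    where

    -- Induction on the remaining actions, with one history common to all `r`. The next payments do
    -- not depend on `r`, but the answers may, and then the histories separate. The induction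
    -- hypothesis still speaks of one common answer at a time, so `moving` has to reconcile the two;
    -- for the `r` whose answer deviates it can fall back on `floor`, which holds for every history.
    run-potential : ∀ t h θ → Inv θ → Ψ θ ≤ uniform R λ r → u r θ * value r t h θ
    run-potential zero    h θ inv = stopping θ inv
    run-potential (suc t) h θ inv with A h
    ... | halt b = stopping θ inv
    ... | move m = moving m θ inv (λ r o → value r t (response o ∷ h) (next m θ))
      (λ o → run-potential t (response o ∷ h) (next m θ) (preserved m θ inv))
      (λ r o → value≥floor r t (response o ∷ h) (next m θ))
    ... | flip   = begin
      Ψ θ
        ≡⟨ lemma₁ (Ψ θ) ⟩
      ½ * (Ψ θ + Ψ θ)
        ≤⟨ *-monoˡ-≤ 0≤½ (+-mono-≤ (run-potential t (coin true ∷ h) θ inv) (run-potential t (coin false ∷ h) θ inv)) ⟩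
      ½ * (uniform R (F true) + uniform R (F false))
        ≡⟨ cong (½ *_) (uniform-+ R (F true) (F false)) ⟨
      ½ * uniform R (λ r → F true r + F false r)
        ≡⟨ uniform-*ˡ R ½ (λ r → F true r + F false r) ⟨
      uniform R (λ r → ½ * (F true r + F false r))
        ≡⟨ uniform-cong R (λ r → lemma₂ (u r θ) (G true r) (G false r)) ⟩
      uniform R (λ r → u r θ * (½ * (G true r + G false r))) ∎
      where
      open ≤-Reasoning
      G F : Bool → B → ℚ
      G b r = value r t (coin b ∷ h) θ
      F b r = u r θ * G b r
      lemma₁ : ∀ a → a ≡ ½ * (a + a)
      lemma₁ = solve-∀ ℚ-ring
      lemma₂ : ∀ u a b → ½ * (u * a + u * b) ≡ u * (½ * (a + b))
      lemma₂ = solve-∀ ℚ-ring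

-- Payments

sum-updateAt : ∀ {n} (v : Fin n → ℚ) j f → sum (updateAt v j f) + v j ≡ sum v + f (v j)
sum-updateAt v zero    f = lemma (v zero) (f (v zero)) (sum (v ∘ suc))
  where
  lemma : ∀ a b c → b + c + a ≡ a + c + b
  lemma = solve-∀ ℚ-ring
sum-updateAt v (suc j) f = begin
  v zero + sum (updateAt (v ∘ suc) j f) + v (suc j)    ≡⟨ +-assoc (v zero) (sum (updateAt (v ∘ suc) j f)) (v (suc j)) ⟩
  v zero + (sum (updateAt (v ∘ suc) j f) + v (suc j))  ≡⟨ +-congˡ (v zero) (sum-updateAt (v ∘ suc) j f) ⟩
  v zero + (sum (v ∘ suc) + f (v (suc j)))             ≡⟨ +-assoc (v zero) (sum (v ∘ suc)) (f (v (suc j))) ⟨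
  v zero + sum (v ∘ suc) + f (v (suc j))               ∎
  where open ≡-Reasoning

updateAt-mono : ∀ {n} (v : Fin n → ℚ) j {δ} → 0ℚ ≤ δ → ∀ k → v k ≤ updateAt v j (_+ δ) k
updateAt-mono v zero    {δ} 0≤δ zero    = ≤-by δ 0≤δ refl
updateAt-mono v zero    0≤δ (suc k) = ≤-refl
updateAt-mono v (suc j) 0≤δ zero    = ≤-refl
updateAt-mono v (suc j) 0≤δ (suc k) = updateAt-mono (v ∘ suc) j 0≤δ k

modify-mono : ∀ {w} (θ : Payments w) i j {δ} → 0ℚ ≤ δ → ∀ i′ j′ → θ i′ j′ ≤ modify {w} θ i j (_+ δ) i′ j′
modify-mono θ i j {δ} 0≤δ i′ j′ with i′ Fin.≟ i
... | yes refl = subst (λ row → θ i j′ ≤ row j′) (sym (updateAt-updates i θ)) (updateAt-mono (θ i) j 0≤δ j′)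
... | no i′≢i  = ≤-reflexive (cong (λ row → row j′) (sym (updateAt-minimal i′ i θ i′≢i)))

online-mono : ∀ {w} (x : Input w) (c : Costs w) m θ i j → θ i j ≤ proj₁ (onlineStep x c m θ) i j
online-mono {w} x c (invest i′ j′ δ 0<δ) θ = modify-mono {w} θ i′ j′ (<⇒≤ 0<δ)

module _ {w : ℕ} where

  -- Read off the payments rather than the answers received: payments only grow, so a touched row
  -- stays touched, and no history has to be inspected.
  Touched : Vec ℕ w → Vector ℚ w → Set
  Touched r ρ = ∃[ j ] fromℕ (lookup r j) ≤ ρ j

  touched? : ∀ r ρ → Dec (Touched r ρ)
  touched? r ρ = Fin.any? λ j → fromℕ (lookup r j) ≤? ρ j

  touched untouched : Vec ℕ w → Vector ℚ w → ℚ
  touched   r ρ = indicator (touched? r ρ)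
  untouched r ρ = 1ℚ - touched r ρ

  touched-mono : ∀ {r ρ ρ′} → (∀ j → ρ j ≤ ρ′ j) → Touched r ρ → Touched r ρ′
  touched-mono ρ≤ρ′ (j , r≤ρ) = j , ≤-trans r≤ρ (ρ≤ρ′ j)

outputs : ∀ {w} → Bool → Payments w → Maybe Bool → ℚ
outputs b θ o = indicator (≡-dec Bool._≟_ o (just b))

-- A single tribe under an online algorithm

module _ {w : ℕ} (A : OnlineAlgorithm w) (i : Fin (2 ℕ.^ w)) where

  -- The part of the answer 0 on which row `i` of the input has no influence.
  silentZero : Vec ℕ w → Payments w → Maybe Bool → ℚ
  silentZero r θ o = outputs {w} false θ o * untouched r (θ i)

  module _ (x : Input w) (c : Costs w) where

    private
      r = lookup c i

    run-silentZero-touched : ∀ t h θ → Touched r (θ i) → run (onlineStep x c) A (silentZero r) t h θ ≡ 0ℚ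
    run-silentZero-touched t h θ τ = trans
      (≤-antisym
        (run-mono step A T pres (λ θ o τ → ≤-reflexive (zero-at θ o τ)) t h θ τ)
        (run-mono step A T pres (λ θ o τ → ≤-reflexive (sym (zero-at θ o τ))) t h θ τ))
      (run-const step A 0ℚ t h θ)
      where
      step = onlineStep x c
      T : Payments w → Set
      T θ = Touched r (θ i)
      pres : ∀ m θ → T θ → T (proj₁ (step m θ))
      pres m θ = touched-mono {r = r} (online-mono x c m θ i)
      zero-at : ∀ θ o → T θ → silentZero r θ o ≡ 0ℚ
      zero-at θ o τ = trans (cong (λ q → outputs {w} false θ o * (1ℚ - q)) (indicator-yes (touched? r (θ i)) τ))
        (*-zeroʳ (outputs {w} false θ o))

  -- While tribe `i` is untouched, every investment in it is answered by `nothing`, whatever its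
  -- input row is. Once it is touched, `silentZero` is 0 on both sides for good.
  run-silentZero-invariant : ∀ x c ρ t h θ →
    run (onlineStep x c) A (silentZero (lookup c i)) t h θ ≡
    run (onlineStep (x Vec.[ i ]≔ ρ) c) A (silentZero (lookup c i)) t h θ
  run-silentZero-invariant x c ρ = run-agree (onlineStep x c) (onlineStep x′ c) A
    (λ θ → Touched (lookup c i) (θ i)) agree (run-silentZero-touched x c) (run-silentZero-touched x′ c)
    where
    x′ = x Vec.[ i ]≔ ρ
    agree : ∀ m θ →
      Touched (lookup c i) (proj₁ (onlineStep x c m θ) i) × Touched (lookup c i) (proj₁ (onlineStep x′ c m θ) i)
      ⊎ onlineStep x c m θ ≡ onlineStep x′ c m θ
    agree (invest i′ j δ 0<δ) θ = cases (i′ Fin.≟ i) (touched? (lookup c i) (θ′ i))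
      where
      θ′ = modify {w} θ i′ j (_+ δ)
      answer : Vec Bool w → Maybe Bool
      answer row = if ⌊ fromℕ (entry c i′ j) ≤? θ′ i′ j ⌋ then just (lookup row j) else nothing
      silent : i′ ≡ i → ¬ Touched (lookup c i) (θ′ i) → ∀ row → answer row ≡ nothing
      silent refl ¬τ row = if-no (fromℕ (entry c i j) ≤? θ′ i j) λ c≤θ → ¬τ (j , c≤θ)
      cases : Dec (i′ ≡ i) → Dec (Touched (lookup c i) (θ′ i)) →
        Touched (lookup c i) (θ′ i) × Touched (lookup c i) (θ′ i) ⊎
        (θ′ , answer (lookup x i′)) ≡ (θ′ , answer (lookup x′ i′))
      cases _ (yes τ) = inj₁ (τ , τ)
      cases (yes i′≡i) (no ¬τ) = inj₂ (cong (θ′ ,_)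
        (trans (silent i′≡i ¬τ (lookup x i′)) (sym (silent i′≡i ¬τ (lookup x′ i′)))))
      cases (no i′≢i)  (no ¬τ) = inj₂ (cong (λ row → θ′ , answer row) (sym (lookup∘updateAt′ i′ i i′≢i x)))

  -- Only the cost row of tribe `i` is random here. Of its law the potential argument uses just
  -- `cheap`: payments of total b touch the tribe with probability at most b/w.
  module Potential (x : Input w) (c : Costs w) (R : List (Vec ℕ w)) {r₀} (r₀∈R : r₀ ∈ R)
    (cheap : ∀ ρ → (∀ j → 0ℚ ≤ ρ j) → fromℕ w * (1ℚ - uniform R (λ r → untouched r ρ)) ≤ sum ρ) where

    s : Vector ℚ w → ℚ
    s ρ = uniform R λ r → untouched r ρ

    half : ℚ
    half = ½ * fromℕ w

    -- The integral of w(1 - s) - w/2 for s from 0 to `a`. When the untouched probability falls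
    -- through s, the payments are at least w(1 - s) by `cheap`, and the probability mass then lost
    -- is charged `half`. With a charge h in place of w/2 the integral up to 1 would be w/2 - h, so
    -- `half` is the largest charge for which the start has a nonnegative potential.
    Φ : ℚ → ℚ
    Φ a = half * (a * (1ℚ - a))

    excess : Vec ℕ w → Payments w → ℚ
    excess r θ = sum (θ i) - half * touched r (θ i)

    step : Vec ℕ w → Step w (Investment w)
    step r = onlineStep x (c Vec.[ i ]≔ r)

    value : Vec ℕ w → ℕ → List Observation → Payments w → ℚ
    value r = run (step r) A (λ θ _ → excess r θ)

    0≤half : 0ℚ ≤ half
    0≤half = 0≤* 0≤½ (0≤fromℕ w)

    0≤untouched : ∀ (r : Vec ℕ w) ρ → 0ℚ ≤ untouched r ρ
    0≤untouched r ρ = p≤q⇒0≤q-p (indicator≤1 (touched? r ρ))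

    untouched≤1 : ∀ (r : Vec ℕ w) ρ → untouched r ρ ≤ 1ℚ
    untouched≤1 r ρ = ≤-by (touched r ρ) (0≤indicator (touched? r ρ)) (lemma (touched r ρ))
      where
      lemma : ∀ a → 1ℚ - a + a ≡ 1ℚ
      lemma = solve-∀ ℚ-ring

    0≤s : ∀ ρ → 0ℚ ≤ s ρ
    0≤s ρ = 0≤uniform R λ r _ → 0≤untouched r ρ

    s≤1 : ∀ ρ → s ρ ≤ 1ℚ
    s≤1 ρ = uniform-≤-const r₀∈R λ r _ → untouched≤1 r ρ

    s-antitone : ∀ {ρ ρ′} → (∀ j → ρ j ≤ ρ′ j) → s ρ′ ≤ s ρ
    s-antitone {ρ} {ρ′} ρ≤ρ′ = uniform-mono R λ r _ →
      +-monoʳ-≤ 1ℚ (neg-antimono-≤ (indicator-mono (touched? r ρ) (touched? r ρ′) (touched-mono {r = r} ρ≤ρ′)))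

    Paid : Payments w → Set
    Paid θ = ∀ j → 0ℚ ≤ θ i j

    next : Investment w → Payments w → Payments w
    next (invest i′ j δ _) θ = modify {w} θ i′ j (_+ δ)

    next-mono : ∀ m θ j → θ i j ≤ next m θ i j
    next-mono (invest i′ j δ 0<δ) θ = modify-mono {w} θ i′ j (<⇒≤ 0<δ) i

    next-paid : ∀ m θ → Paid θ → Paid (next m θ)
    next-paid m θ 0≤θ j = ≤-trans (0≤θ j) (next-mono m θ j)

    -- Payments into the tribe only grow, and the charge never exceeds `half`. This bound takes care
    -- of the rows that a move touches: what the algorithm learns from then on is irrelevant.
    value≥floor : ∀ r t h θ → sum (θ i) - half ≤ value r t h θ
    value≥floor r t h θ = subst (_≤ value r t h θ) (run-const (step r) A (sum (θ i) - half) t h θ)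
      (run-mono (step r) A (λ θ′ → sum (θ i) ≤ sum (θ′ i))
        (λ m θ′ le → ≤-trans le (sum-mono (next-mono m θ′)))
        (λ θ′ o le → +-mono-≤ le (neg-antimono-≤ (subst (half * touched r (θ′ i) ≤_) (*-identityʳ half)
          (*-monoˡ-≤ 0≤half (indicator≤1 (touched? r (θ′ i)))))))
        t h θ ≤-refl)

    -- Untouched rows are not charged, so the right side equals `a * b`. By `cheap` this is at least
    -- w a (1 - a), twice the potential.
    stopping : ∀ θ → Paid θ → Φ (s (θ i)) ≤ uniform R λ r → untouched r (θ i) * excess r θ
    stopping θ 0≤θ = begin
      Φ a
        ≤⟨ ≤-by (a * (b - fromℕ w * (1ℚ - a)) + half * (a * (1ℚ - a)))
             (0≤+ (0≤* (0≤s (θ i)) (p≤q⇒0≤q-p (cheap (θ i) 0≤θ))) (0≤* 0≤half (0≤* (0≤s (θ i)) (p≤q⇒0≤q-p (s≤1 (θ i))))))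
             (lemma a b (fromℕ w)) ⟩
      a * b
        ≡⟨ uniform-*ʳ R (λ r → untouched r (θ i)) b ⟨
      uniform R (λ r → untouched r (θ i) * b)
        ≡⟨ uniform-cong R (λ r → pointwise (touched? r (θ i)) b half) ⟩
      uniform R (λ r → untouched r (θ i) * excess r θ) ∎
      where
      open ≤-Reasoning
      a = s (θ i)
      b = sum (θ i)
      lemma : ∀ a b W → ½ * W * (a * (1ℚ - a)) + (a * (b - W * (1ℚ - a)) + ½ * W * (a * (1ℚ - a))) ≡ a * b
      lemma = solve-∀ ℚ-ring
      lemma₁ : ∀ b k → (1ℚ - 1ℚ) * b ≡ (1ℚ - 1ℚ) * (b - k * 1ℚ)
      lemma₁ = solve-∀ ℚ-ring
      lemma₂ : ∀ b k → (1ℚ - 0ℚ) * b ≡ (1ℚ - 0ℚ) * (b - k * 0ℚ)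
      lemma₂ = solve-∀ ℚ-ring
      pointwise : ∀ {P : Set} (P? : Dec P) b k → (1ℚ - indicator P?) * b ≡ (1ℚ - indicator P?) * (b - k * indicator P?)
      pointwise (yes _) = lemma₁
      pointwise (no _)  = lemma₂

    -- An investment in another tribe gets the same answer for every `r` and leaves the payments of
    -- tribe `i` alone. After an investment in tribe `i`, the rows still untouched all see
    -- `nothing`, which is the case `o = nothing` of the hypothesis; the rows just touched, of mass
    -- `a - a′`, are worth at least `b′ - half` by `floor≤V`.
    moving : ∀ m θ → Paid θ → (V : Vec ℕ w → Maybe Bool → ℚ) →
      (∀ o → Φ (s (next m θ i)) ≤ uniform R λ r → untouched r (next m θ i) * V r o) →
      (∀ r o → sum (next m θ i) - half ≤ V r o) →
      Φ (s (θ i)) ≤ uniform R λ r → untouched r (θ i) * V r (proj₂ (step r m θ))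
    moving m@(invest i′ j δ 0<δ) θ 0≤θ V Φ≤V floor≤V = cases (i′ Fin.≟ i)
      where
      θ′ = next m θ
      answer : Vec ℕ w → Maybe Bool
      answer row = if ⌊ fromℕ (lookup row j) ≤? θ′ i′ j ⌋ then just (entry x i′ j) else nothing
      a = s (θ i)
      a′ = s (θ′ i)
      b′ = sum (θ′ i)
      0≤Δ : 0ℚ ≤ a - a′
      0≤Δ = p≤q⇒0≤q-p (s-antitone (next-mono m θ))
      lemma : ∀ a a′ b W →
        ½ * W * (a * (1ℚ - a)) + ((a - a′) * (b - W * (1ℚ - a′)) + ½ * W * ((a - a′) * (a - a′))) ≡
        ½ * W * (a′ * (1ℚ - a′)) + (a - a′) * (b - ½ * W)
      lemma = solve-∀ ℚ-ring
      lemma′ : ∀ a b → a - b ≡ a + - 1ℚ * b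
      lemma′ = solve-∀ ℚ-ring
      U U′ : Vec ℕ w → ℚ
      U  r = untouched r (θ i)
      U′ r = untouched r (θ′ i)
      lost : uniform R (λ r → (U r - U′ r) * (b′ - half)) ≡ (a - a′) * (b′ - half)
      lost = trans (uniform-*ʳ R (λ r → U r - U′ r) (b′ - half)) (cong (_* (b′ - half))
        (trans (uniform-cong R λ r → lemma′ (U r) (U′ r))
        (trans (uniform-+ R U (λ r → - 1ℚ * U′ r))
        (trans (+-congˡ a (uniform-*ˡ R (- 1ℚ) U′)) (sym (lemma′ a a′))))))
      lemma₁ : ∀ g u k → (1ℚ - 1ℚ) * g + (u - (1ℚ - 1ℚ)) * k ≡ u * k
      lemma₁ = solve-∀ ℚ-ring
      lemma₂ : ∀ g k → (1ℚ - 0ℚ) * g + (1ℚ - 0ℚ - (1ℚ - 0ℚ)) * k ≡ (1ℚ - 0ℚ) * g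
      lemma₂ = solve-∀ ℚ-ring
      hit-or-miss : i′ ≡ i → ∀ r (τ? : Dec (Touched r (θ′ i))) → 
        (1ℚ - indicator τ?) * V r nothing + (U r - (1ℚ - indicator τ?)) * (b′ - half) ≤ U r * V r (answer r)
      -- Rows touched before the move fall under this case too; for them `U r` is 0 and both sides
      -- vanish.
      hit-or-miss _ r (yes _) = ≤-trans (≤-reflexive (lemma₁ (V r nothing) (U r) (b′ - half)))
        (*-monoˡ-≤ (0≤untouched r (θ i)) (floor≤V r (answer r)))
      hit-or-miss refl r (no ¬τ) = ≤-reflexive (trans
        (cong (λ u → (1ℚ - 0ℚ) * V r nothing + (u - (1ℚ - 0ℚ)) * (b′ - half)) still)
        (trans (lemma₂ (V r nothing) (b′ - half))
          (cong₂ (λ u o → u * V r o) (sym still) (sym (if-no (fromℕ (lookup r j) ≤? θ′ i j) λ r≤θ → ¬τ (j , r≤θ))))))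
        where
        still : U r ≡ 1ℚ - 0ℚ
        still = cong (λ q → 1ℚ - q) (indicator-no (touched? r (θ i)) (¬τ ∘ touched-mono {r = r} (next-mono m θ)))
      cases : Dec (i′ ≡ i) → Φ a ≤ uniform R λ r → U r * V r (answer (lookup (c Vec.[ i ]≔ r) i′))
      cases (no i′≢i) = subst₂ _≤_ (cong (Φ ∘ s) same-row) (uniform-cong R same-value) (Φ≤V (answer (lookup c i′)))
        where
        same-row : θ′ i ≡ θ i
        same-row = updateAt-minimal i i′ θ (i′≢i ∘ sym)
        same-value : ∀ r → untouched r (θ′ i) * V r (answer (lookup c i′)) ≡
          untouched r (θ i) * V r (answer (lookup (c Vec.[ i ]≔ r) i′))
        same-value r = cong₂ (λ ρ row → untouched r ρ * V r (answer row)) same-row (sym (lookup∘updateAt′ i′ i i′≢i c))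
      cases (yes i′≡i) = begin
        Φ a
          -- `Φ` is concave, so it lies below its tangent at `a′`, with gap
          -- `half * ((a - a′) * (a - a′))`. The slope there is w(1 - a′) - `half`, which is at most
          -- `b′ - half` by `cheap`.
          ≤⟨ ≤-by ((a - a′) * (b′ - fromℕ w * (1ℚ - a′)) + half * ((a - a′) * (a - a′)))
               (0≤+ (0≤* 0≤Δ (p≤q⇒0≤q-p (cheap (θ′ i) (next-paid m θ 0≤θ)))) (0≤* 0≤half (0≤* 0≤Δ 0≤Δ)))
               (lemma a a′ b′ (fromℕ w)) ⟩
        Φ a′ + (a - a′) * (b′ - half)
          ≤⟨ +-monoˡ-≤ ((a - a′) * (b′ - half)) (Φ≤V nothing) ⟩
        uniform R (λ r → U′ r * V r nothing) + (a - a′) * (b′ - half)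
          ≡⟨ +-congˡ (uniform R λ r → U′ r * V r nothing) lost ⟨
        uniform R (λ r → U′ r * V r nothing) + uniform R (λ r → (U r - U′ r) * (b′ - half))
          ≡⟨ uniform-+ R (λ r → U′ r * V r nothing) (λ r → (U r - U′ r) * (b′ - half)) ⟨
        uniform R (λ r → U′ r * V r nothing + (U r - U′ r) * (b′ - half))
          ≤⟨ uniform-mono R (λ r _ → hit-or-miss i′≡i r (touched? r (θ′ i))) ⟩
        uniform R (λ r → U r * V r (answer r))
          ≡⟨ uniform-cong R (λ r → cong (λ row → U r * V r (answer row)) (sym (own-row r i′≡i))) ⟩
        uniform R (λ r → U r * V r (answer (lookup (c Vec.[ i ]≔ r) i′))) ∎
        where
        open ≤-Reasoning
        own-row : ∀ r → i′ ≡ i → lookup (c Vec.[ i ]≔ r) i′ ≡ r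
        own-row r refl = lookup∘updateAt i c

    potential : ∀ t h θ → Paid θ → Φ (s (θ i)) ≤ uniform R λ r → untouched r (θ i) * value r t h θ
    potential = run-potential A R next (λ r m θ → proj₂ (step r m θ)) excess (λ r θ → untouched r (θ i))
      (λ θ → Φ (s (θ i))) Paid next-paid (λ θ → sum (θ i) - half) value≥floor stopping moving

    -- Positive costs make every row untouched at the start, so the weights in `potential` are 1.
    -- The potential there is nonnegative, hence so is the expected `excess`, which is payments
    -- minus charge.
    touching-is-costly : (∀ r → r ∈ R → ∀ j → 0ℚ < fromℕ (lookup r j)) → ∀ t →
      half * uniform R (λ r → run (step r) A (λ θ _ → touched r (θ i)) t [] unpaid) ≤
      uniform R (λ r → run (step r) A (λ θ _ → sum (θ i)) t [] unpaid)
    touching-is-costly positive t = begin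
      half * uniform R T
        ≤⟨ ≤-by (uniform R E) 0≤E refl ⟩
      half * uniform R T + uniform R E
        ≡⟨ cong (_+ uniform R E) (uniform-*ˡ R half T) ⟨
      uniform R (λ r → half * T r) + uniform R E
        ≡⟨ uniform-+ R (λ r → half * T r) E ⟨
      uniform R (λ r → half * T r + E r)
        ≤⟨ uniform-mono R (λ r _ → split r) ⟩
      uniform R (λ r → run (step r) A (λ θ _ → sum (θ i)) t [] unpaid) ∎
      where
      open ≤-Reasoning
      T E : Vec ℕ w → ℚ
      T r = run (step r) A (λ θ _ → touched r (θ i)) t [] unpaid
      E r = value r t [] unpaid
      0ρ : Vector ℚ w
      0ρ _ = 0ℚ
      drop : uniform R (λ r → untouched r 0ρ * E r) ≤ uniform R E
      drop = uniform-mono R λ r r∈R → ≤-reflexive (trans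
        (cong (λ τ → (1ℚ - τ) * E r) (indicator-no (touched? r 0ρ) λ (j , c≤0) → <-irrefl refl (<-≤-trans (positive r r∈R j) c≤0)))
        (*-identityˡ (E r)))
      0≤E : 0ℚ ≤ uniform R E
      0≤E = ≤-trans (0≤* 0≤half (0≤* (0≤s 0ρ) (p≤q⇒0≤q-p (s≤1 0ρ))))
        (≤-trans (potential t [] unpaid λ _ → ≤-refl) drop)
      lemma : ∀ a b → a + (b - a) ≡ b
      lemma = solve-∀ ℚ-ring
      split : ∀ r → half * T r + E r ≤ run (step r) A (λ θ _ → sum (θ i)) t [] unpaid
      split r = begin
        half * T r + E r
          ≡⟨ cong (_+ E r) (run-*ˡ (step r) A half (λ θ _ → touched r (θ i)) t [] unpaid) ⟨
        run (step r) A (λ θ _ → half * touched r (θ i)) t [] unpaid + E r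
          ≡⟨ run-+ (step r) A (λ θ _ → half * touched r (θ i)) (λ θ _ → excess r θ) t [] unpaid ⟨
        run (step r) A (λ θ o → half * touched r (θ i) + excess r θ) t [] unpaid
          ≤⟨ run-≤ (step r) A (λ θ o → ≤-reflexive (lemma (half * touched r (θ i)) (sum (θ i)))) t [] unpaid ⟩
        run (step r) A (λ θ _ → sum (θ i)) t [] unpaid ∎

-- Symmetry of uniformly random permutations

indicator-cong : ∀ {P Q : Set} (P? : Dec P) (Q? : Dec Q) → (P → Q) → (Q → P) → indicator P? ≡ indicator Q?
indicator-cong P? Q? P⇒Q Q⇒P = ≤-antisym (indicator-mono P? Q? P⇒Q) (indicator-mono Q? P? Q⇒P)

module _ {A : Set} where

  0≤Σ : ∀ (xs : List A) {F} → (∀ x → 0ℚ ≤ F x) → 0ℚ ≤ Σ xs F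
  0≤Σ []       0≤F = ≤-refl
  0≤Σ (x ∷ xs) 0≤F = 0≤+ (0≤F x) (0≤Σ xs 0≤F)

  Σ-filter : ∀ {P : Pred A _} (P? : Decidable P) xs F → Σ (filter P? xs) F ≡ Σ xs λ x → indicator (P? x) * F x
  Σ-filter P? []       F = refl
  Σ-filter P? (x ∷ xs) F with P? x
  ... | yes _ = cong₂ _+_ (sym (*-identityˡ (F x))) (Σ-filter P? xs F)
  ... | no _  = trans (Σ-filter P? xs F)
    (trans (sym (+-identityˡ (Σ xs λ x → indicator (P? x) * F x)))
      (cong (_+ Σ xs λ x → indicator (P? x) * F x) (sym (*-zeroˡ (F x)))))

  Σ-uniform-swap : ∀ {B : Set} (xs : List A) (ys : List B) (F : A → B → ℚ) →
    Σ xs (λ x → uniform ys (F x)) ≡ uniform ys λ y → Σ xs λ x → F x y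
  Σ-uniform-swap []       ys F = sym (uniform-0 ys)
  Σ-uniform-swap (x ∷ xs) ys F = trans (+-congˡ (uniform ys (F x)) (Σ-uniform-swap xs ys F))
    (sym (uniform-+ ys (F x) λ y → Σ xs λ x → F x y))

  Σ-tuples-map : ∀ (X : List A) (f : A → A) → (∀ G → Σ X (G ∘ f) ≡ Σ X G) →
    ∀ n F → Σ (tuples X n) (F ∘ Vec.map f) ≡ Σ (tuples X n) F
  Σ-tuples-map X f inv zero    F = refl
  Σ-tuples-map X f inv (suc n) F = begin
    Σ (tuples X (suc n)) (F ∘ Vec.map f)
      ≡⟨ Σ-cartesianProductWith _∷_ X (tuples X n) (F ∘ Vec.map f) ⟩
    Σ X (λ a → Σ (tuples X n) λ v → F (f a ∷ Vec.map f v))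
      ≡⟨ Σ-cong X (λ a → Σ-tuples-map X f inv n (λ v → F (f a ∷ v))) ⟩
    Σ X (λ a → Σ (tuples X n) λ v → F (f a ∷ v))
      ≡⟨ inv (λ a → Σ (tuples X n) λ v → F (a ∷ v)) ⟩
    Σ X (λ a → Σ (tuples X n) λ v → F (a ∷ v))
      ≡⟨ Σ-cartesianProductWith _∷_ X (tuples X n) F ⟨
    Σ (tuples X (suc n)) F ∎
    where open ≡-Reasoning

Σ-applyUpTo-suc : ∀ (f : ℕ → ℕ) n F → Σ (applyUpTo f (suc n)) F ≡ Σ (applyUpTo f n) F + F (f n)
Σ-applyUpTo-suc f n F = begin
  Σ (applyUpTo f (suc n)) F            ≡⟨ cong (λ xs → Σ xs F) (List.applyUpTo-∷ʳ f n) ⟨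
  Σ (applyUpTo f n ∷ʳ f n) F           ≡⟨ Σ-++ (applyUpTo f n) (f n ∷ []) F ⟩
  Σ (applyUpTo f n) F + (F (f n) + 0ℚ) ≡⟨ +-congˡ (Σ (applyUpTo f n) F) (+-identityʳ (F (f n))) ⟩
  Σ (applyUpTo f n) F + F (f n)        ∎
  where open ≡-Reasoning

-- The transposition of `k` and `k + 1`. Adjacent transpositions suffice, because the probabilities
-- of neighbouring costs are compared one step at a time.
swap : ℕ → ℕ → ℕ
swap zero    zero          = 1
swap zero    (suc zero)    = 0
swap zero    (suc (suc n)) = suc (suc n)
swap (suc k) zero          = zero
swap (suc k) (suc n)       = suc (swap k n)

swap-involutive : ∀ k n → swap k (swap k n) ≡ n
swap-involutive zero    zero          = refl
swap-involutive zero    (suc zero)    = refl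
swap-involutive zero    (suc (suc n)) = refl
swap-involutive (suc k) zero          = refl
swap-involutive (suc k) (suc n)       = cong suc (swap-involutive k n)

swap-lower : ∀ k → swap k k ≡ suc k
swap-lower zero    = refl
swap-lower (suc k) = cong suc (swap-lower k)

Σ-applyUpTo-swap : ∀ k n (f : ℕ → ℕ) F → suc k ℕ.< n → Σ (applyUpTo (f ∘ swap k) n) F ≡ Σ (applyUpTo f n) F
Σ-applyUpTo-swap zero    (suc zero)    f F (s≤s ())
Σ-applyUpTo-swap zero    (suc (suc n)) f F _         = lemma (F (f 0)) (F (f 1)) (Σ (applyUpTo (λ m → f (suc (suc m))) n) F)
  where
  lemma : ∀ a b c → b + (a + c) ≡ a + (b + c)
  lemma = solve-∀ ℚ-ring
Σ-applyUpTo-swap (suc k) (suc n)       f F (s≤s k<n) = +-congˡ (F (f 0)) (Σ-applyUpTo-swap k n (f ∘ suc) F k<n)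

costs : ℕ → List ℕ
costs w = applyUpTo suc w

Σ-costs-swap : ∀ w k → suc k ℕ.< w → ∀ F → Σ (costs w) (F ∘ swap (suc k)) ≡ Σ (costs w) F
Σ-costs-swap w k k<w F = begin
  Σ (costs w) (F ∘ swap (suc k))            ≡⟨ Σ-map (swap (suc k)) (costs w) F ⟨
  Σ (List.map (swap (suc k)) (costs w)) F   ≡⟨ cong (λ xs → Σ xs F) (List.map-applyUpTo suc (swap (suc k)) w) ⟩
  Σ (applyUpTo (suc ∘ swap k) w) F          ≡⟨ Σ-applyUpTo-swap k w suc F k<w ⟩
  Σ (costs w) F                             ∎
  where open ≡-Reasoning

Distinct : ∀ {n} → Vec ℕ n → Set
Distinct = AllPairs λ a b → ¬ a ≡ b

distinct? : ∀ {n} → Decidable (Distinct {n})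
distinct? = allPairs? λ a b → ¬? (a ℕ.≟ b)

distinct-swap : ∀ k {n} {v : Vec ℕ n} → Distinct v → Distinct (Vec.map (swap k) v)
distinct-swap k v! = AllPairs.map⁺ (AllPairs.map (λ a≢b eq →
  a≢b (trans (sym (swap-involutive k _)) (trans (cong (swap k) eq) (swap-involutive k _)))) v!)

map-swap-involutive : ∀ k {n} (v : Vec ℕ n) → Vec.map (swap k) (Vec.map (swap k) v) ≡ v
map-swap-involutive k v = trans (sym (map-∘ (swap k) (swap k) v)) (trans (map-cong (swap-involutive k) v) (map-id v))

-- Relabelling the costs permutes all tuples and preserves distinctness. As costs start at 1,
-- `swap (suc k)` exchanges `k + 1` and `k + 2`, and the hypothesis says that the larger of them is
-- still a cost.
uniform-permutations-swap : ∀ w k → suc k ℕ.< w → ∀ F →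
  uniform (permutations w) (F ∘ Vec.map (swap (suc k))) ≡ uniform (permutations w) F
uniform-permutations-swap w k k<w F = begin
  uniform P (F ∘ π)               ≡⟨ uniform-Σ P (F ∘ π) ⟩
  Σ P (F ∘ π) * recip (length P)  ≡⟨ cong (_* recip (length P)) Σ-invariant ⟩
  Σ P F * recip (length P)        ≡⟨ uniform-Σ P F ⟨
  uniform P F                     ∎
  where
  open ≡-Reasoning
  P = permutations w
  T = tuples (costs w) w
  π : Vec ℕ w → Vec ℕ w
  π = Vec.map (swap (suc k))
  Σ-invariant : Σ P (F ∘ π) ≡ Σ P F
  Σ-invariant = begin
    Σ P (F ∘ π)
      ≡⟨ Σ-filter distinct? T (F ∘ π) ⟩
    Σ T (λ v → indicator (distinct? v) * F (π v))
      ≡⟨ Σ-cong T (λ v → cong (_* F (π v)) (indicator-cong (distinct? v) (distinct? (π v)) (distinct-swap (suc k))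
           (subst Distinct (map-swap-involutive (suc k) v) ∘ distinct-swap (suc k)))) ⟩
    Σ T (λ v → indicator (distinct? (π v)) * F (π v))
      ≡⟨ Σ-tuples-map (costs w) (swap (suc k)) (Σ-costs-swap w k k<w) w (λ v → indicator (distinct? v) * F v) ⟩
    Σ T (λ v → indicator (distinct? v) * F v)
      ≡⟨ Σ-filter distinct? T F ⟨
    Σ P F ∎

permutation-costs : ∀ {w v} → v ∈ permutations w → ∀ j → lookup v j ∈ costs w
permutation-costs {w} v∈P = tuples-lookup (costs w) w (proj₁ (∈-filter⁻ distinct? {xs = tuples (costs w) w} v∈P))

permutation-distinct : ∀ {w v} → v ∈ permutations w → Distinct v
permutation-distinct {w} v∈P = proj₂ (∈-filter⁻ distinct? {xs = tuples (costs w) w} v∈P)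

identity∈permutations : ∀ w → Vec.tabulate (suc ∘ toℕ) ∈ permutations w
identity∈permutations w = ∈-filter⁺ distinct?
  (lookup-tuples (costs w) (Vec.tabulate (suc ∘ toℕ))
    λ i → subst (_∈ costs w) (sym (lookup∘tabulate (suc ∘ toℕ) i)) (∈-applyUpTo⁺ suc (Fin.toℕ<n i)))
  (AllPairs.tabulate⁺ λ i≢j eq → i≢j (Fin.toℕ-injective (ℕ.suc-injective eq)))

-- The bound 1 would not survive the induction; with `a ≤ n` in it, the new case `a ≡ suc n` is
-- disjoint from the earlier ones.
Σ-indicator≤1 : ∀ a n → Σ (costs n) (λ v → indicator (a ℕ.≟ v)) ≤ indicator (a ℕ.≤? n)
Σ-indicator≤1 a zero    = 0≤indicator (a ℕ.≤? 0)
Σ-indicator≤1 a (suc n) = begin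
  Σ (costs (suc n)) (λ v → indicator (a ℕ.≟ v))                ≡⟨ Σ-applyUpTo-suc suc n (λ v → indicator (a ℕ.≟ v)) ⟩
  Σ (costs n) (λ v → indicator (a ℕ.≟ v)) + indicator (a ℕ.≟ suc n) ≤⟨ +-monoˡ-≤ (indicator (a ℕ.≟ suc n)) (Σ-indicator≤1 a n) ⟩
  indicator (a ℕ.≤? n) + indicator (a ℕ.≟ suc n)               ≤⟨ disjoint (a ℕ.≤? n) (a ℕ.≟ suc n) (a ℕ.≤? suc n) ⟩
  indicator (a ℕ.≤? suc n) ∎
  where
  open ≤-Reasoning
  disjoint : (p : Dec (a ℕ.≤ n)) (q : Dec (a ≡ suc n)) (r : Dec (a ℕ.≤ suc n)) → indicator p + indicator q ≤ indicator r
  disjoint (yes a≤n) (yes refl) r = ⊥-elim (ℕ.1+n≰n a≤n)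
  disjoint (yes a≤n) (no _)     r = ≤-reflexive (sym (indicator-yes r (ℕ.m≤n⇒m≤1+n a≤n)))
  disjoint (no _)    q          r = ≤-trans (≤-reflexive (+-identityˡ (indicator q))) (indicator-mono q r ℕ.≤-reflexive)

≤-Σ-indicator : ∀ {a} xs → a ∈ xs → ∀ (F : ℕ → ℚ) → (∀ v → 0ℚ ≤ F v) → F a ≤ Σ xs λ v → F v * indicator (a ℕ.≟ v)
≤-Σ-indicator {a} (_ ∷ xs) (here refl) F 0≤F = ≤-by (Σ xs λ v → F v * indicator (a ℕ.≟ v))
  (0≤Σ xs λ v → 0≤* (0≤F v) (0≤indicator (a ℕ.≟ v)))
  (cong (_+ Σ xs λ v → F v * indicator (a ℕ.≟ v))
    (trans (sym (*-identityʳ (F a))) (cong (F a *_) (sym (indicator-yes (a ℕ.≟ a) refl)))))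
≤-Σ-indicator {a} (b ∷ xs) (there a∈xs) F 0≤F = ≤-trans (≤-Σ-indicator xs a∈xs F 0≤F)
  (≤-by (F b * indicator (a ℕ.≟ b)) (0≤* (0≤F b) (0≤indicator (a ℕ.≟ b))) (+-comm _ (F b * indicator (a ℕ.≟ b))))

Σ-indicator≤ : ∀ n {q} → 0ℚ ≤ q → Σ (costs n) (λ v → indicator (fromℕ v ≤? q)) ≤ q
Σ-indicator≤ zero    0≤q = 0≤q
Σ-indicator≤ (suc n) {q} 0≤q = ≤-trans (≤-reflexive (Σ-applyUpTo-suc suc n F)) (cases (fromℕ (suc n) ≤? q))
  where
  F : ℕ → ℚ
  F v = indicator (fromℕ v ≤? q)
  count : Σ (costs n) F ≤ fromℕ n
  count = begin
    Σ (costs n) F                  ≤⟨ Σ-mono (costs n) (λ v _ → indicator≤1 (fromℕ v ≤? q)) ⟩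
    Σ (costs n) (λ _ → 1ℚ)         ≡⟨ Σ-const (costs n) 1ℚ ⟩
    fromℕ (length (costs n)) * 1ℚ  ≡⟨ *-identityʳ (fromℕ (length (costs n))) ⟩
    fromℕ (length (costs n))       ≡⟨ cong fromℕ (List.length-applyUpTo suc n) ⟩
    fromℕ n                        ∎
    where open ≤-Reasoning
  cases : (d : Dec (fromℕ (suc n) ≤ q)) → Σ (costs n) F + indicator d ≤ q
  cases (yes n<q) = ≤-trans (≤-trans (+-monoˡ-≤ 1ℚ count) (≤-reflexive (trans (+-comm (fromℕ n) 1ℚ) (sym (fromℕ-suc n))))) n<q
  cases (no _)    = ≤-trans (≤-reflexive (+-identityʳ (Σ (costs n) F))) (Σ-indicator≤ n 0≤q)

module _ {w : ℕ} (j : Fin w) where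

  private
    P = permutations w

  cost-probability : ℕ → ℚ
  cost-probability v = uniform P λ c → indicator (lookup c j ℕ.≟ v)

  cost-probability-const : ∀ n → n ℕ.< w → cost-probability (suc n) ≡ cost-probability 1
  cost-probability-const zero    _   = refl
  cost-probability-const (suc n) n<w = begin
    cost-probability (suc (suc n))
      ≡⟨ uniform-cong P (λ c → indicator-cong (lookup c j ℕ.≟ suc (suc n)) (lookup (Vec.map (swap (suc n)) c) j ℕ.≟ suc n)
           (λ eq → trans (lookup-map j (swap (suc n)) c) (trans (cong (swap (suc n)) eq) swap-upper))
           (λ eq → trans (sym (swap-involutive (suc n) (lookup c j)))
             (trans (cong (swap (suc n)) (trans (sym (lookup-map j (swap (suc n)) c)) eq)) (swap-lower (suc n))))) ⟩
    uniform P (λ c → indicator (lookup (Vec.map (swap (suc n)) c) j ℕ.≟ suc n))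
      ≡⟨ uniform-permutations-swap w n n<w (λ c → indicator (lookup c j ℕ.≟ suc n)) ⟩
    cost-probability (suc n)
      ≡⟨ cost-probability-const n (ℕ.<-trans (ℕ.n<1+n n) n<w) ⟩
    cost-probability 1 ∎
    where
    open ≡-Reasoning
    swap-upper : swap (suc n) (suc (suc n)) ≡ suc n
    swap-upper = trans (cong (swap (suc n)) (sym (swap-lower (suc n)))) (swap-involutive (suc n) (suc n))

  cost-probability-∈ : ∀ v → v ∈ costs w → cost-probability v ≡ cost-probability 1
  cost-probability-∈ v v∈ with n , n<w , refl ← ∈-applyUpTo⁻ suc v∈ = cost-probability-const n n<w

  -- The w costs are equally likely and exclude each other. An upper bound on the probability is
  -- enough, so permutations need not be counted.
  cost-probability≤recip : fromℕ w * cost-probability 1 ≤ 1ℚ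
  cost-probability≤recip = begin
    fromℕ w * cost-probability 1
      ≡⟨ cong (λ n → fromℕ n * cost-probability 1) (List.length-applyUpTo suc w) ⟨
    fromℕ (length (costs w)) * cost-probability 1
      ≡⟨ Σ-const (costs w) (cost-probability 1) ⟨
    Σ (costs w) (λ _ → cost-probability 1)
      ≤⟨ Σ-mono (costs w) (λ v v∈ → ≤-reflexive (sym (cost-probability-∈ v v∈))) ⟩
    Σ (costs w) cost-probability
      ≡⟨ Σ-uniform-swap (costs w) P (λ v c → indicator (lookup c j ℕ.≟ v)) ⟩
    uniform P (λ c → Σ (costs w) λ v → indicator (lookup c j ℕ.≟ v))
      ≤⟨ uniform-≤-const (identity∈permutations w)
           (λ c _ → ≤-trans (Σ-indicator≤1 (lookup c j) w) (indicator≤1 (lookup c j ℕ.≤? w))) ⟩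
    1ℚ ∎
    where open ≤-Reasoning

  -- Split according to the cost of the variable: each cost has probability at most 1/w, and at most
  -- `q` of them are affordable.
  reveal-probability : ∀ {q} → 0ℚ ≤ q → fromℕ w * uniform P (λ c → indicator (fromℕ (lookup c j) ≤? q)) ≤ q
  reveal-probability {q} 0≤q = begin
    fromℕ w * uniform P (λ c → F (lookup c j))
      ≤⟨ *-monoˡ-≤ (0≤fromℕ w) (uniform-mono P λ c c∈P → ≤-Σ-indicator (costs w) (permutation-costs c∈P j) F 0≤F) ⟩
    fromℕ w * uniform P (λ c → Σ (costs w) λ v → F v * indicator (lookup c j ℕ.≟ v))
      ≡⟨ cong (fromℕ w *_) (Σ-uniform-swap (costs w) P (λ v c → F v * indicator (lookup c j ℕ.≟ v))) ⟨
    fromℕ w * Σ (costs w) (λ v → uniform P λ c → F v * indicator (lookup c j ℕ.≟ v))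
      ≡⟨ cong (fromℕ w *_) (Σ-cong (costs w) λ v → uniform-*ˡ P (F v) (λ c → indicator (lookup c j ℕ.≟ v))) ⟩
    fromℕ w * Σ (costs w) (λ v → F v * cost-probability v)
      ≤⟨ *-monoˡ-≤ (0≤fromℕ w) (Σ-mono (costs w) λ v v∈ → ≤-reflexive
           (trans (cong (F v *_) (cost-probability-∈ v v∈)) (*-comm (F v) p))) ⟩
    fromℕ w * Σ (costs w) (λ v → p * F v)
      ≡⟨ cong (fromℕ w *_) (Σ-*ˡ (costs w) p F) ⟩
    fromℕ w * (p * Σ (costs w) F)
      ≡⟨ *-assoc (fromℕ w) p (Σ (costs w) F) ⟨
    fromℕ w * p * Σ (costs w) F
      ≤⟨ *-monoʳ-≤ (0≤Σ (costs w) 0≤F) cost-probability≤recip ⟩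
    1ℚ * Σ (costs w) F
      ≡⟨ *-identityˡ (Σ (costs w) F) ⟩
    Σ (costs w) F
      ≤⟨ Σ-indicator≤ w 0≤q ⟩
    q ∎
    where
    open ≤-Reasoning
    p = cost-probability 1
    F : ℕ → ℚ
    F v = indicator (fromℕ v ≤? q)
    0≤F : ∀ v → 0ℚ ≤ F v
    0≤F v = 0≤indicator (fromℕ v ≤? q)

0≤sum : ∀ {n} {f : Fin n → ℚ} → (∀ i → 0ℚ ≤ f i) → 0ℚ ≤ sum f
0≤sum {zero}  0≤f = ≤-refl
0≤sum {suc n} 0≤f = 0≤+ (0≤f zero) (0≤sum (0≤f ∘ suc))

≤-sum : ∀ {n} {f : Fin n → ℚ} → (∀ i → 0ℚ ≤ f i) → ∀ i → f i ≤ sum f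
≤-sum {suc n} {f} 0≤f zero    = ≤-by (sum (f ∘ suc)) (0≤sum (0≤f ∘ suc)) refl
≤-sum {suc n} {f} 0≤f (suc i) = ≤-trans (≤-sum (0≤f ∘ suc) i) (≤-by (f zero) (0≤f zero) (+-comm (sum (f ∘ suc)) (f zero)))

-- A union bound over the variables of the tribe. It is the hypothesis `cheap` of `Potential` for
-- uniformly random permutations.
touch-probability : ∀ {w} (ρ : Vector ℚ w) → (∀ j → 0ℚ ≤ ρ j) →
  fromℕ w * (1ℚ - uniform (permutations w) (λ r → untouched r ρ)) ≤ sum ρ
touch-probability {w} ρ 0≤ρ = begin
  fromℕ w * (1ℚ - uniform P (λ r → untouched r ρ))
    ≡⟨ cong (fromℕ w *_) complement ⟩
  fromℕ w * uniform P (λ r → touched r ρ)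
    ≤⟨ *-monoˡ-≤ (0≤fromℕ w) (uniform-mono P λ r _ → union r (touched? r ρ)) ⟩
  fromℕ w * uniform P (λ r → sum λ j → I r j)
    ≡⟨ cong (fromℕ w *_) (uniform-sum P I) ⟩
  fromℕ w * sum (λ j → uniform P λ r → I r j)
    ≡⟨ sum-*ˡ (fromℕ w) (λ j → uniform P λ r → I r j) ⟨
  sum (λ j → fromℕ w * uniform P λ r → I r j)
    ≤⟨ sum-mono (λ j → reveal-probability j (0≤ρ j)) ⟩
  sum ρ ∎
  where
  open ≤-Reasoning
  P = permutations w
  I : Vec ℕ w → Fin w → ℚ
  I r j = indicator (fromℕ (lookup r j) ≤? ρ j)
  union : ∀ r (τ? : Dec (Touched r ρ)) → indicator τ? ≤ sum (I r)
  union r (yes (j , r≤ρ)) = ≤-trans (≤-reflexive (sym (indicator-yes (fromℕ (lookup r j) ≤? ρ j) r≤ρ)))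
    (≤-sum (λ j → 0≤indicator (fromℕ (lookup r j) ≤? ρ j)) j)
  union r (no _) = 0≤sum λ j → 0≤indicator (fromℕ (lookup r j) ≤? ρ j)
  lemma : ∀ a → 1ℚ - a ≡ 1ℚ + - 1ℚ * a
  lemma = solve-∀ ℚ-ring
  lemma′ : ∀ a → 1ℚ - (1ℚ + - 1ℚ * a) ≡ a
  lemma′ = solve-∀ ℚ-ring
  complement : 1ℚ - uniform P (λ r → untouched r ρ) ≡ uniform P λ r → touched r ρ
  complement = begin-equality
    1ℚ - uniform P (λ r → untouched r ρ)
      ≡⟨ cong (λ q → 1ℚ - q) (uniform-cong P λ r → lemma (touched r ρ)) ⟩
    1ℚ - uniform P (λ r → 1ℚ + - 1ℚ * touched r ρ)
      ≡⟨ cong (λ q → 1ℚ - q) (uniform-+ P (λ _ → 1ℚ) (λ r → - 1ℚ * touched r ρ)) ⟩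
    1ℚ - (uniform P (λ _ → 1ℚ) + uniform P (λ r → - 1ℚ * touched r ρ))
      ≡⟨ cong₂ (λ p q → 1ℚ - (p + q)) (uniform-const (identity∈permutations w) 1ℚ) (uniform-*ˡ P (- 1ℚ) (λ r → touched r ρ)) ⟩
    1ℚ - (1ℚ + - 1ℚ * uniform P (λ r → touched r ρ))
      ≡⟨ lemma′ (uniform P λ r → touched r ρ) ⟩
    uniform P (λ r → touched r ρ) ∎

-- Random inputs

⟦_⟧ : Bool → ℚ
⟦ b ⟧ = if b then 1ℚ else 0ℚ

0≤⟦⟧ : ∀ b → 0ℚ ≤ ⟦ b ⟧
0≤⟦⟧ true  = 0≤1
0≤⟦⟧ false = ≤-refl

⟦⟧≤1 : ∀ b → ⟦ b ⟧ ≤ 1ℚ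
⟦⟧≤1 true  = ≤-refl
⟦⟧≤1 false = 0≤1

bits : List Bool
bits = true ∷ false ∷ []

all : ∀ {n} → Vec Bool n → Bool
all = Vec.foldr′ _∧_ true

uniform-bits : ∀ F → uniform bits F ≡ ½ * (F true + F false)
uniform-bits F = lemma (F true) (F false)
  where
  lemma : ∀ a b → (a + (b + 0ℚ)) * ½ ≡ ½ * (a + b)
  lemma = solve-∀ ℚ-ring

uniform-all : ∀ n → uniform (tuples bits n) (λ r → ⟦ all r ⟧) ≡ recip (2 ℕ.^ n)
uniform-all zero    = uniform-tuples-zero bits (λ r → ⟦ all r ⟧)
uniform-all (suc n) = begin
  uniform (tuples bits (suc n)) (λ r → ⟦ all r ⟧)
    ≡⟨ uniform-tuples-suc bits n (λ r → ⟦ all r ⟧) ⟩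
  uniform bits (λ b → uniform (tuples bits n) λ v → ⟦ b ∧ all v ⟧)
    ≡⟨ uniform-bits (λ b → uniform (tuples bits n) λ v → ⟦ b ∧ all v ⟧) ⟩
  ½ * (uniform (tuples bits n) (λ v → ⟦ all v ⟧) + uniform (tuples bits n) (λ _ → 0ℚ))
    ≡⟨ cong₂ (λ a b → ½ * (a + b)) (uniform-all n) (uniform-0 (tuples bits n)) ⟩
  ½ * (recip (2 ℕ.^ n) + 0ℚ)
    ≡⟨ cong (½ *_) (+-identityʳ (recip (2 ℕ.^ n))) ⟩
  ½ * recip (2 ℕ.^ n)
    ≡⟨ recip-* 2 (2 ℕ.^ n) ⟨
  recip (2 ℕ.^ suc n) ∎
  where open ≡-Reasoning

true∈bits : true ∈ bits
true∈bits = here refl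

module _ {w : ℕ} where

  rows : List (Vec Bool w)
  rows = tuples bits w

  row₀ : Vec Bool w
  row₀ = Vec.replicate w true

  row₀∈rows : row₀ ∈ rows
  row₀∈rows = replicate-∈ bits true∈bits w

  -- The probability that a given tribe is satisfied, by `uniform-all`.
  p : ℚ
  p = recip (2 ℕ.^ w)

  satisfied : ∀ {n} → Vec (Vec Bool w) n → Bool
  satisfied x = Vec.foldr′ _∨_ false (Vec.map all x)

  zeros : ∀ {n} → Vec (Vec Bool w) n → ℚ
  zeros x = ⟦ not (satisfied x) ⟧

  zero-probability : ℕ → ℚ
  zero-probability n = uniform (tuples rows n) zeros

  ⟦⟧-∨ : ∀ a b → ⟦ not (a ∨ b) ⟧ ≡ (1ℚ - ⟦ a ⟧) * ⟦ not b ⟧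
  ⟦⟧-∨ true  b = sym (*-zeroˡ ⟦ not b ⟧)
  ⟦⟧-∨ false b = sym (*-identityˡ ⟦ not b ⟧)

  zero-probability-suc : ∀ n → zero-probability (suc n) ≡ (1ℚ - p) * zero-probability n
  zero-probability-suc n = begin
    uniform (tuples rows (suc n)) zeros
      ≡⟨ uniform-tuples-suc rows n zeros ⟩
    uniform rows (λ r → uniform (tuples rows n) λ x → ⟦ not (all r ∨ satisfied x) ⟧)
      ≡⟨ uniform-cong rows (λ r → trans (uniform-cong (tuples rows n) λ x → ⟦⟧-∨ (all r) (satisfied x))
           (uniform-*ˡ (tuples rows n) (1ℚ - ⟦ all r ⟧) zeros)) ⟩
    uniform rows (λ r → (1ℚ - ⟦ all r ⟧) * zero-probability n)
      ≡⟨ uniform-*ʳ rows (λ r → 1ℚ - ⟦ all r ⟧) (zero-probability n) ⟩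
    uniform rows (λ r → 1ℚ - ⟦ all r ⟧) * zero-probability n
      ≡⟨ cong (_* zero-probability n) complement ⟩
    (1ℚ - p) * zero-probability n ∎
    where
    open ≡-Reasoning
    lemma : ∀ a → 1ℚ - a ≡ 1ℚ + - 1ℚ * a
    lemma = solve-∀ ℚ-ring
    complement : uniform rows (λ r → 1ℚ - ⟦ all r ⟧) ≡ 1ℚ - p
    complement = begin
      uniform rows (λ r → 1ℚ - ⟦ all r ⟧)
        ≡⟨ uniform-cong rows (λ r → lemma ⟦ all r ⟧) ⟩
      uniform rows (λ r → 1ℚ + - 1ℚ * ⟦ all r ⟧)
        ≡⟨ uniform-+ rows (λ _ → 1ℚ) (λ r → - 1ℚ * ⟦ all r ⟧) ⟩
      uniform rows (λ _ → 1ℚ) + uniform rows (λ r → - 1ℚ * ⟦ all r ⟧)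
        ≡⟨ cong₂ _+_ (uniform-const row₀∈rows 1ℚ) (trans (uniform-*ˡ rows (- 1ℚ) (λ r → ⟦ all r ⟧)) (cong (- 1ℚ *_) (uniform-all w))) ⟩
      1ℚ + - 1ℚ * p
        ≡⟨ lemma p ⟨
      1ℚ - p ∎

  zero-probability-+ : ∀ m n → zero-probability (m ℕ.+ n) ≡ zero-probability m * zero-probability n
  zero-probability-+ zero    n = sym (trans (cong (_* zero-probability n) (uniform-tuples-zero rows zeros)) (*-identityˡ (zero-probability n)))
  zero-probability-+ (suc m) n = begin
    zero-probability (suc (m ℕ.+ n))                    ≡⟨ zero-probability-suc (m ℕ.+ n) ⟩
    (1ℚ - p) * zero-probability (m ℕ.+ n)               ≡⟨ cong ((1ℚ - p) *_) (zero-probability-+ m n) ⟩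
    (1ℚ - p) * (zero-probability m * zero-probability n) ≡⟨ *-assoc (1ℚ - p) (zero-probability m) (zero-probability n) ⟨
    (1ℚ - p) * zero-probability m * zero-probability n  ≡⟨ cong (_* zero-probability n) (zero-probability-suc m) ⟨
    zero-probability (suc m) * zero-probability n       ∎
    where open ≡-Reasoning

  p≤1 : p ≤ 1ℚ
  p≤1 = subst (_≤ 1ℚ) (uniform-all w) (uniform-≤-const row₀∈rows λ r _ → ⟦⟧≤1 (all r))

  zero-probability-bernoulli : ∀ n → 1ℚ - fromℕ n * p ≤ zero-probability n
  zero-probability-bernoulli zero    = ≤-reflexive (trans (lemma p) (sym (uniform-tuples-zero rows zeros)))
    where
    lemma : ∀ p → 1ℚ - 0ℚ * p ≡ 1ℚ
    lemma = solve-∀ ℚ-ring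
  zero-probability-bernoulli (suc n) = begin
    1ℚ - fromℕ (suc n) * p          ≡⟨ cong (λ m → 1ℚ - m * p) (fromℕ-suc n) ⟩
    1ℚ - (1ℚ + fromℕ n) * p         ≤⟨ ≤-by (fromℕ n * (p * p)) (0≤* (0≤fromℕ n) (0≤* (0≤recip (2 ℕ.^ w)) (0≤recip (2 ℕ.^ w)))) (lemma (fromℕ n) p) ⟩
    (1ℚ - p) * (1ℚ - fromℕ n * p)   ≤⟨ *-monoˡ-≤ (p≤q⇒0≤q-p p≤1) (zero-probability-bernoulli n) ⟩
    (1ℚ - p) * zero-probability n   ≡⟨ zero-probability-suc n ⟨
    zero-probability (suc n)        ∎
    where
    open ≤-Reasoning
    lemma : ∀ n p → 1ℚ - (1ℚ + n) * p + n * (p * p) ≡ (1ℚ - p) * (1ℚ - n * p)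
    lemma = solve-∀ ℚ-ring

  -- Inputs with a single satisfied tribe

  othersUnsat : ∀ {n} → Fin n → Vec (Vec Bool w) n → ℚ
  othersUnsat zero    (r ∷ x) = zeros x
  othersUnsat (suc i) (r ∷ x) = ⟦ not (all r) ⟧ * othersUnsat i x

  0≤othersUnsat : ∀ {n} i (x : Vec (Vec Bool w) n) → 0ℚ ≤ othersUnsat i x
  0≤othersUnsat zero    (r ∷ x) = 0≤⟦⟧ (not (satisfied x))
  0≤othersUnsat (suc i) (r ∷ x) = 0≤* (0≤⟦⟧ (not (all r))) (0≤othersUnsat i x)

  othersUnsat-update : ∀ {n} i (x : Vec (Vec Bool w) n) r → othersUnsat i (x Vec.[ i ]≔ r) ≡ othersUnsat i x
  othersUnsat-update zero    (_ ∷ x) r = refl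
  othersUnsat-update (suc i) (s ∷ x) r = cong (⟦ not (all s) ⟧ *_) (othersUnsat-update i x r)

  zeros≤othersUnsat : ∀ {n} i (x : Vec (Vec Bool w) n) → zeros x ≤ othersUnsat i x
  zeros≤othersUnsat zero    (r ∷ x) = cases (all r) (satisfied x)
    where
    cases : ∀ a b → ⟦ not (a ∨ b) ⟧ ≤ ⟦ not b ⟧
    cases true  b = 0≤⟦⟧ (not b)
    cases false b = ≤-refl
  zeros≤othersUnsat (suc i) (r ∷ x) = cases (all r) (zeros≤othersUnsat i x)
    where
    cases : ∀ a {q} → zeros x ≤ q → ⟦ not (a ∨ satisfied x) ⟧ ≤ ⟦ not a ⟧ * q
    cases true  {q} z≤q = ≤-reflexive (sym (*-zeroˡ q))
    cases false {q} z≤q = ≤-trans z≤q (≤-reflexive (sym (*-identityˡ q)))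

  othersUnsat≤1 : ∀ {n} i (x : Vec (Vec Bool w) n) → othersUnsat i x ≤ 1ℚ
  othersUnsat≤1 zero    (r ∷ x) = ⟦⟧≤1 (not (satisfied x))
  othersUnsat≤1 (suc i) (r ∷ x) = ≤-trans (*-monoˡ-≤ (0≤⟦⟧ (not (all r))) (othersUnsat≤1 i x))
    (≤-trans (≤-reflexive (*-identityʳ ⟦ not (all r) ⟧)) (⟦⟧≤1 (not (all r))))

  -- At most one summand is nonzero.
  sum-sole≤ : ∀ {n} (x : Vec (Vec Bool w) n) (a : Fin n → ℚ) {q} → 0ℚ ≤ q → (∀ i → 0ℚ ≤ a i) → (∀ i → a i ≤ q) →
    sum (λ i → ⟦ all (lookup x i) ⟧ * (othersUnsat i x * a i)) ≤ ⟦ satisfied x ⟧ * q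
  sum-sole≤ [] a {q} _ _ _ = ≤-reflexive (sym (*-zeroˡ q))
  sum-sole≤ {suc n} (r ∷ x) a {q} 0≤q 0≤a a≤q = cases (all r)
    where
    open ≤-Reasoning
    S : Fin n → ℚ
    S i = ⟦ all (lookup x i) ⟧ * (othersUnsat i x * a (suc i))
    lemma₁ : ∀ s o a → s * (0ℚ * o * a) ≡ 0ℚ
    lemma₁ = solve-∀ ℚ-ring
    lemma₂ : ∀ s o a → s * (1ℚ * o * a) ≡ s * (o * a)
    lemma₂ = solve-∀ ℚ-ring
    cases : ∀ b → ⟦ b ⟧ * (zeros x * a zero) + sum (λ i → ⟦ all (lookup x i) ⟧ * (⟦ not b ⟧ * othersUnsat i x * a (suc i))) ≤
      ⟦ b ∨ satisfied x ⟧ * q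
    cases true = begin
      1ℚ * (zeros x * a zero) + sum (λ i → ⟦ all (lookup x i) ⟧ * (0ℚ * othersUnsat i x * a (suc i)))
        ≡⟨ cong₂ _+_ (*-identityˡ (zeros x * a zero)) (trans (sum-cong-≗ λ i → lemma₁ ⟦ all (lookup x i) ⟧ (othersUnsat i x) (a (suc i)))
             (trans (sum-const n 0ℚ) (*-zeroʳ (fromℕ n)))) ⟩
      zeros x * a zero + 0ℚ
        ≡⟨ +-identityʳ (zeros x * a zero) ⟩
      zeros x * a zero
        ≤⟨ *-monoʳ-≤ (0≤a zero) (⟦⟧≤1 (not (satisfied x))) ⟩
      1ℚ * a zero
        ≤⟨ *-monoˡ-≤ 0≤1 (a≤q zero) ⟩
      1ℚ * q ∎
    cases false = begin
      0ℚ * (zeros x * a zero) + sum (λ i → ⟦ all (lookup x i) ⟧ * (1ℚ * othersUnsat i x * a (suc i)))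
        ≡⟨ cong₂ _+_ (*-zeroˡ (zeros x * a zero)) (sum-cong-≗ λ i → lemma₂ ⟦ all (lookup x i) ⟧ (othersUnsat i x) (a (suc i))) ⟩
      0ℚ + sum S
        ≡⟨ +-identityˡ (sum S) ⟩
      sum S
        ≤⟨ sum-sole≤ x (a ∘ suc) 0≤q (0≤a ∘ suc) (a≤q ∘ suc) ⟩
      ⟦ satisfied x ⟧ * q ∎

  -- Satisfying a tribe that went untouched turns a correct answer 0 into an error.
  disguise : ∀ n (q : Vec (Vec Bool w) n → ℚ) (u T : Fin n → Vec (Vec Bool w) n → ℚ) →
    (∀ i x → 0ℚ ≤ u i x) → (∀ i x → u i x ≤ q x) → (∀ x → 0ℚ ≤ q x) → (∀ i x → 0ℚ ≤ T i x) →
    (∀ i x → q x ≤ u i x + T i x) → (∀ i x r → u i (x Vec.[ i ]≔ r) ≡ u i x) →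
    fromℕ n * p * uniform (tuples rows n) (λ x → zeros x * q x) ≤
    uniform (tuples rows n) (λ x → ⟦ satisfied x ⟧ * q x) + p * sum (λ i → uniform (tuples rows n) (T i))
  disguise n q u T 0≤u u≤q 0≤q 0≤T q≤u+T u-invariant = begin
    fromℕ n * p * E Z
      ≡⟨ lemma (fromℕ n) p (E Z) ⟩
    p * (fromℕ n * E Z)
      ≡⟨ cong (p *_) (sum-const n (E Z)) ⟨
    p * sum (λ (_ : Fin n) → E Z)
      ≤⟨ *-monoˡ-≤ (0≤recip (2 ℕ.^ w)) (sum-mono λ i → uniform-mono (tuples rows n) λ x _ → split i x) ⟩
    p * sum (λ i → E λ x → O i x + T i x)
      ≡⟨ cong (p *_) (trans (sum-cong-≗ λ i → uniform-+ (tuples rows n) (O i) (T i)) (∑-distrib-+ (E ∘ O) (E ∘ T))) ⟩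
    p * (sum (E ∘ O) + sum (E ∘ T))
      ≡⟨ *-distribˡ-+ p (sum (E ∘ O)) (sum (E ∘ T)) ⟩
    p * sum (E ∘ O) + p * sum (E ∘ T)
      -- Neither `othersUnsat i` nor `u i` depends on row `i`, so requiring that row to be satisfied
      -- costs exactly the factor `p`.
      ≡⟨ cong (_+ p * sum (E ∘ T)) (trans (sym (sum-*ˡ p (E ∘ O))) (sum-cong-≗ resampled)) ⟩
    sum (λ i → E λ x → ⟦ all (lookup x i) ⟧ * O i x) + p * sum (E ∘ T)
      ≡⟨ cong (_+ p * sum (E ∘ T)) (uniform-sum (tuples rows n) (λ x i → ⟦ all (lookup x i) ⟧ * O i x)) ⟨
    E (λ x → sum λ i → ⟦ all (lookup x i) ⟧ * O i x) + p * sum (E ∘ T)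
      ≤⟨ +-monoˡ-≤ (p * sum (E ∘ T)) (uniform-mono (tuples rows n) λ x _ →
           sum-sole≤ x (λ i → u i x) (0≤q x) (λ i → 0≤u i x) (λ i → u≤q i x)) ⟩
    E (λ x → ⟦ satisfied x ⟧ * q x) + p * sum (E ∘ T) ∎
    where
    open ≤-Reasoning
    E : (Vec (Vec Bool w) n → ℚ) → ℚ
    E = uniform (tuples rows n)
    Z : Vec (Vec Bool w) n → ℚ
    Z x = zeros x * q x
    O : Fin n → Vec (Vec Bool w) n → ℚ
    O i x = othersUnsat i x * u i x
    lemma : ∀ n p z → n * p * z ≡ p * (n * z)
    lemma = solve-∀ ℚ-ring
    split : ∀ i x → Z x ≤ O i x + T i x
    split i x = begin
      zeros x * q x                                 ≤⟨ *-monoʳ-≤ (0≤q x) (zeros≤othersUnsat i x) ⟩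
      othersUnsat i x * q x                              ≤⟨ *-monoˡ-≤ (0≤othersUnsat i x) (q≤u+T i x) ⟩
      othersUnsat i x * (u i x + T i x)                  ≡⟨ *-distribˡ-+ (othersUnsat i x) (u i x) (T i x) ⟩
      othersUnsat i x * u i x + othersUnsat i x * T i x       ≤⟨ +-monoʳ-≤ (O i x) (*-monoʳ-≤ (0≤T i x) (othersUnsat≤1 i x)) ⟩
      othersUnsat i x * u i x + 1ℚ * T i x               ≡⟨ +-congˡ (O i x) (*-identityˡ (T i x)) ⟩
      O i x + T i x                                 ∎
    resampled : ∀ i → p * E (O i) ≡ E λ x → ⟦ all (lookup x i) ⟧ * O i x
    resampled i = sym (begin-equality
      E (λ x → ⟦ all (lookup x i) ⟧ * O i x)
        ≡⟨ resample rows row₀∈rows i (λ x → ⟦ all (lookup x i) ⟧ * O i x) ⟩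
      E (λ x → uniform rows λ r → ⟦ all (lookup (x Vec.[ i ]≔ r) i) ⟧ * O i (x Vec.[ i ]≔ r))
        ≡⟨ uniform-cong (tuples rows n) (λ x → uniform-cong rows λ r → cong₂ _*_
             (cong (λ r → ⟦ all r ⟧) (lookup∘updateAt i x)) (cong₂ _*_ (othersUnsat-update i x r) (u-invariant i x r))) ⟩
      E (λ x → uniform rows λ r → ⟦ all r ⟧ * O i x)
        ≡⟨ uniform-cong (tuples rows n) (λ x → trans (uniform-*ʳ rows (λ r → ⟦ all r ⟧) (O i x)) (cong (_* O i x) (uniform-all w))) ⟩
      E (λ x → p * O i x)
        ≡⟨ uniform-*ˡ (tuples rows n) p (O i) ⟩
      p * E (O i) ∎)

¼ : ℚ
¼ = + 1 / 4

fromℕ-recip : ∀ n .{{_ : ℕ.NonZero n}} → fromℕ n * recip n ≡ 1ℚ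
fromℕ-recip (suc n) = fromℕ*recip n

-- Bernoulli's inequality for all 2^w tribes would only give 0. For half of them it gives 1/2, and
-- the two halves are independent. Halving needs `1 ≤ w`; at width 1 the bound is attained.
zero-probability≥¼ : ∀ w → 1 ℕ.≤ w → ¼ ≤ zero-probability {w} (2 ℕ.^ w)
zero-probability≥¼ w@(suc v) _ = begin
  ½ * ½                        ≤⟨ *-monoˡ-≤ 0≤½ half≤ ⟩
  ½ * zero-probability {w} K   ≤⟨ *-monoʳ-≤ (≤-trans 0≤½ half≤) half≤ ⟩
  zero-probability {w} K * zero-probability {w} K  ≡⟨ zero-probability-+ {w} K K ⟨
  zero-probability {w} (K ℕ.+ K)  ≡⟨ cong (λ n → zero-probability {w} (K ℕ.+ n)) (ℕ.+-identityʳ K) ⟨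
  zero-probability {w} (2 ℕ.^ w) ∎
  where
  open ≤-Reasoning
  K = 2 ℕ.^ v
  instance
    _ = ℕ.m^n≢0 2 v
  lemma : ∀ k r → 1ℚ - k * (½ * r) ≡ 1ℚ - ½ * (k * r)
  lemma = solve-∀ ℚ-ring
  half≤ : ½ ≤ zero-probability {w} K
  half≤ = begin
    1ℚ - ½ * 1ℚ                   ≡⟨ cong (λ q → 1ℚ - ½ * q) (fromℕ-recip K) ⟨
    1ℚ - ½ * (fromℕ K * recip K)  ≡⟨ lemma (fromℕ K) (recip K) ⟨
    1ℚ - fromℕ K * (½ * recip K)  ≡⟨ cong (λ q → 1ℚ - fromℕ K * q) (recip-* 2 K) ⟨
    1ℚ - fromℕ K * p {w}          ≤⟨ zero-probability-bernoulli {w} K ⟩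
    zero-probability {w} K        ∎

module Instance (w : ℕ) where

  N : ℕ
  N = 2 ℕ.^ w

  P : List (Vec ℕ w)
  P = permutations w

  inputs : List (Input w)
  inputs = tuples rows N

  costVectors : List (Costs w)
  costVectors = tuples P N

  input₀∈ : Vec.replicate N row₀ ∈ inputs
  input₀∈ = replicate-∈ rows row₀∈rows N

  costs₀∈ : Vec.replicate N (Vec.tabulate (suc ∘ toℕ)) ∈ costVectors
  costs₀∈ = replicate-∈ P (identity∈permutations w) N

-- The online lower bound

module Online {w : ℕ} (1≤w : 1 ℕ.≤ w) (A : OnlineAlgorithm w) (t : ℕ) where

  open Instance w

  instance
    N≢0 = ℕ.m^n≢0 2 w

  after : (Costs w → Payments w → Maybe Bool → ℚ) → Input w → ℚ
  after g x = uniform costVectors λ c → run (onlineStep x c) A (g c) t [] unpaid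

  after-mono : ∀ {g g′} → (∀ c θ o → g c θ o ≤ g′ c θ o) → ∀ x → after g x ≤ after g′ x
  after-mono g≤g′ x = uniform-mono costVectors λ c _ → run-≤ (onlineStep x c) A (g≤g′ c) t [] unpaid

  after-+ : ∀ g g′ x → after (λ c θ o → g c θ o + g′ c θ o) x ≡ after g x + after g′ x
  after-+ g g′ x = trans (uniform-cong costVectors λ c → run-+ (onlineStep x c) A (g c) (g′ c) t [] unpaid)
    (uniform-+ costVectors (λ c → run (onlineStep x c) A (g c) t [] unpaid) (λ c → run (onlineStep x c) A (g′ c) t [] unpaid))

  after-const : ∀ k x → after (λ _ _ _ → k) x ≡ k
  after-const k x = trans (uniform-cong costVectors λ c → run-const (onlineStep x c) A k t [] unpaid)
    (uniform-const costs₀∈ k)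

  0≤after : ∀ {g} → (∀ c θ o → 0ℚ ≤ g c θ o) → ∀ x → 0ℚ ≤ after g x
  0≤after {g} 0≤g x = subst (_≤ after g x) (after-const 0ℚ x) (after-mono 0≤g x)

  expectOnline-after : ∀ g → expectOnline A g t ≡ uniform inputs λ x → after (λ _ → g x) x
  expectOnline-after g = uniform-cartesianProductWith _,_ inputs costVectors _

  out : Bool → Costs w → Payments w → Maybe Bool → ℚ
  out b _ = outputs {w} b

  T S : Fin N → Costs w → Payments w → Maybe Bool → ℚ
  T i c θ _ = touched (lookup c i) (θ i)
  S i c = silentZero A i (lookup c i)

  0≤T : ∀ i c θ o → 0ℚ ≤ T i c θ o
  0≤T i c θ o = 0≤indicator (touched? (lookup c i) (θ i))

  0≤out : ∀ b c θ o → 0ℚ ≤ out b c θ o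
  0≤out b c θ o = 0≤indicator (≡-dec Bool._≟_ o (just b))

  0≤S : ∀ i c θ o → 0ℚ ≤ S i c θ o
  0≤S i c θ o = 0≤* (0≤out false c θ o) (p≤q⇒0≤q-p (indicator≤1 (touched? (lookup c i) (θ i))))

  S≤out : ∀ i c θ o → S i c θ o ≤ out false c θ o
  S≤out i c θ o = ≤-by (out false c θ o * T i c θ o) (0≤* (0≤out false c θ o) (0≤T i c θ o)) (lemma (out false c θ o) (T i c θ o))
    where
    lemma : ∀ a b → a * (1ℚ - b) + a * b ≡ a
    lemma = solve-∀ ℚ-ring

  out≤S+T : ∀ i c θ o → out false c θ o ≤ S i c θ o + T i c θ o
  out≤S+T i c θ o = ≤-by ((1ℚ - out false c θ o) * T i c θ o)
    (0≤* (p≤q⇒0≤q-p (indicator≤1 (≡-dec Bool._≟_ o (just false)))) (0≤T i c θ o)) (lemma (out false c θ o) (T i c θ o))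
    where
    lemma : ∀ a b → a + (1ℚ - a) * b ≡ a * (1ℚ - b) + b
    lemma = solve-∀ ℚ-ring

  out-exclusive : ∀ c θ o → out true c θ o + out false c θ o ≤ 1ℚ
  out-exclusive c θ nothing      = 0≤1
  out-exclusive c θ (just true)  = ≤-refl
  out-exclusive c θ (just false) = ≤-refl

  q : Input w → ℚ
  q = after (out false)

  u τ : Fin N → Input w → ℚ
  u i = after (S i)
  τ i = after (T i)

  E : (Input w → ℚ) → ℚ
  E = uniform inputs

  success : Input w → ℚ
  success x = after (λ _ → correct x) x

  -- When f = 1, the answers 0 and 1 exclude each other; when f = 0, success means answering 0. The
  -- wrong answers 0 stay on the left because `disguise` bounds them from below.
  success≤ : ∀ x → success x + ⟦ satisfied x ⟧ * q x ≤ ⟦ satisfied x ⟧ + zeros x * q x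
  success≤ x = cases (satisfied x)
    where
    cases : ∀ b → after (out b) x + ⟦ b ⟧ * q x ≤ ⟦ b ⟧ + ⟦ not b ⟧ * q x
    cases false = ≤-reflexive (lemma (q x))
      where
      lemma : ∀ a → a + 0ℚ * a ≡ 0ℚ + 1ℚ * a
      lemma = solve-∀ ℚ-ring
    cases true = begin
      after (out true) x + 1ℚ * q x                       ≡⟨ +-congˡ (after (out true) x) (*-identityˡ (q x)) ⟩
      after (out true) x + after (out false) x            ≡⟨ after-+ (out true) (out false) x ⟨
      after (λ c θ o → out true c θ o + out false c θ o) x ≤⟨ after-mono out-exclusive x ⟩
      after (λ _ _ _ → 1ℚ) x                              ≡⟨ after-const 1ℚ x ⟩
      1ℚ                                                  ≡⟨ lemma (q x) ⟩
      1ℚ + 0ℚ * q x                                       ∎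
      where
      open ≤-Reasoning
      lemma : ∀ a → 1ℚ ≡ 1ℚ + 0ℚ * a
      lemma = solve-∀ ℚ-ring

  satisfied-probability : E (λ x → ⟦ satisfied x ⟧) ≤ 1ℚ - ¼
  satisfied-probability = begin
    E (λ x → ⟦ satisfied x ⟧)
      ≡⟨ lemma₁ (E λ x → ⟦ satisfied x ⟧) (zero-probability {w} N) ⟩
    E (λ x → ⟦ satisfied x ⟧) + zero-probability {w} N - zero-probability {w} N
      ≡⟨ cong (_- zero-probability {w} N) (trans (sym (uniform-+ inputs (λ x → ⟦ satisfied x ⟧) zeros))
           (trans (uniform-cong inputs λ x → total (satisfied x)) (uniform-const input₀∈ 1ℚ))) ⟩
    1ℚ - zero-probability {w} N
      ≤⟨ +-monoʳ-≤ 1ℚ (neg-antimono-≤ (zero-probability≥¼ w 1≤w)) ⟩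
    1ℚ - ¼ ∎
    where
    open ≤-Reasoning
    lemma₁ : ∀ a b → a ≡ a + b - b
    lemma₁ = solve-∀ ℚ-ring
    total : ∀ b → ⟦ b ⟧ + ⟦ not b ⟧ ≡ 1ℚ
    total true  = refl
    total false = refl

  success-needs-touching : E success ≤ (1ℚ - ¼) + p {w} * sum (E ∘ τ)
  success-needs-touching = begin
    E success
      ≤⟨ ≤-by (F + Z - (E success + FQ)) (p≤q⇒0≤q-p balance) (lemma (E success) F Z FQ) ⟩
    F + (Z - FQ)
      ≤⟨ +-mono-≤ satisfied-probability gap ⟩
    (1ℚ - ¼) + p {w} * sum (E ∘ τ) ∎
    where
    open ≤-Reasoning
    F = E λ x → ⟦ satisfied x ⟧
    Z = E λ x → zeros x * q x
    FQ = E λ x → ⟦ satisfied x ⟧ * q x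
    lemma : ∀ s f z g → s + (f + z - (s + g)) ≡ f + (z - g)
    lemma = solve-∀ ℚ-ring
    balance : E success + FQ ≤ F + Z
    balance = subst₂ _≤_ (uniform-+ inputs success (λ x → ⟦ satisfied x ⟧ * q x)) (uniform-+ inputs (λ x → ⟦ satisfied x ⟧) (λ x → zeros x * q x))
      (uniform-mono inputs λ x _ → success≤ x)
    disguised : Z ≤ FQ + p {w} * sum (E ∘ τ)
    -- The factor `fromℕ N * p` is 1: there are as many tribes as the rarity of a satisfied one
    -- requires.
    disguised = subst (_≤ FQ + p {w} * sum (E ∘ τ)) (trans (cong (_* Z) (fromℕ-recip N)) (*-identityˡ Z))
      (disguise N q u τ (λ i → 0≤after (0≤S i)) (λ i → after-mono (S≤out i)) (0≤after (0≤out false)) (λ i → 0≤after (0≤T i))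
        (λ i x → ≤-trans (after-mono (out≤S+T i) x) (≤-reflexive (after-+ (S i) (T i) x)))
        (λ i x r → uniform-cong costVectors λ c → sym (run-silentZero-invariant A i x c r t [] unpaid)))
    lemma′ : ∀ a b c → (a - b) + (b + c - a) ≡ c
    lemma′ = solve-∀ ℚ-ring
    gap : Z - FQ ≤ p {w} * sum (E ∘ τ)
    gap = ≤-by (FQ + p {w} * sum (E ∘ τ) - Z) (p≤q⇒0≤q-p disguised) (lemma′ Z FQ (p {w} * sum (E ∘ τ)))

  spent : Fin N → Costs w → Payments w → Maybe Bool → ℚ
  spent i _ θ _ = sum (θ i)

  half : ℚ
  half = ½ * fromℕ w

  permutation-positive : ∀ r → r ∈ P → ∀ j → 0ℚ < fromℕ (lookup r j)
  permutation-positive r r∈P j with n , _ , eq ← ∈-applyUpTo⁻ suc (permutation-costs r∈P j) =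
    subst (λ v → 0ℚ < fromℕ v) (sym eq) (positive⁻¹ (fromℕ (suc n)) {{normalize-pos (suc n) 1}})

  touching-cost : ∀ i x → half * τ i x ≤ after (spent i) x
  touching-cost i x = begin
    half * uniform costVectors (R (T i))
      ≡⟨ cong (half *_) (resampled (T i)) ⟩
    half * uniform costVectors (λ c → uniform P λ r → R (T i) (c Vec.[ i ]≔ r))
      ≡⟨ uniform-*ˡ costVectors half (λ c → uniform P λ r → R (T i) (c Vec.[ i ]≔ r)) ⟨
    uniform costVectors (λ c → half * uniform P λ r → R (T i) (c Vec.[ i ]≔ r))
      ≤⟨ uniform-mono costVectors (λ c _ → row c) ⟩
    uniform costVectors (λ c → uniform P λ r → R (spent i) (c Vec.[ i ]≔ r))
      ≡⟨ resampled (spent i) ⟨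
    uniform costVectors (R (spent i)) ∎
    where
    open ≤-Reasoning
    R : (Costs w → Payments w → Maybe Bool → ℚ) → Costs w → ℚ
    R g c = run (onlineStep x c) A (g c) t [] unpaid
    resampled : ∀ g → uniform costVectors (R g) ≡ uniform costVectors λ c → uniform P λ r → R g (c Vec.[ i ]≔ r)
    resampled g = resample P (identity∈permutations w) i (R g)
    row : ∀ c → half * uniform P (λ r → R (T i) (c Vec.[ i ]≔ r)) ≤ uniform P λ r → R (spent i) (c Vec.[ i ]≔ r)
    row c = subst (λ e → half * e ≤ uniform P λ r → R (spent i) (c Vec.[ i ]≔ r))
      (uniform-cong P λ r → cong (λ row → run (onlineStep x (c Vec.[ i ]≔ r)) A (λ θ _ → touched row (θ i)) t [] unpaid)
        (sym (lookup∘updateAt i c)))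
      (Potential.touching-is-costly A i x c P (identity∈permutations w) touch-probability permutation-positive t)

  expected-cost : half * sum (E ∘ τ) ≤ expectOnline A totalCost t
  expected-cost = begin
    half * sum (E ∘ τ)
      ≡⟨ sum-*ˡ half (E ∘ τ) ⟨
    sum (λ i → half * E (τ i))
      ≡⟨ sum-cong-≗ (λ i → sym (uniform-*ˡ inputs half (τ i))) ⟩
    sum (λ i → E λ x → half * τ i x)
      ≤⟨ sum-mono (λ i → uniform-mono inputs λ x _ → touching-cost i x) ⟩
    sum (λ i → E (after (spent i)))
      ≡⟨ uniform-sum inputs (λ x i → after (spent i) x) ⟨
    E (λ x → sum λ i → after (spent i) x)
      ≡⟨ uniform-cong inputs (λ x → trans
           (sym (uniform-sum costVectors λ c i → run (onlineStep x c) A (spent i c) t [] unpaid))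
           (uniform-cong costVectors λ c → sym (run-sum (onlineStep x c) A (λ i → spent i c) t [] unpaid))) ⟩
    E (λ x → after (λ _ → totalCost x) x)
      ≡⟨ expectOnline-after totalCost ⟨
    expectOnline A totalCost t ∎
    where open ≤-Reasoning

  online-bound : ½ * fromℕ (N ℕ.* w) * (expectOnline A correct t - (1ℚ - ¼)) ≤ expectOnline A totalCost t
  online-bound = begin
    ½ * fromℕ (N ℕ.* w) * (expectOnline A correct t - (1ℚ - ¼))
      ≡⟨ cong₂ (λ m s → ½ * m * (s - (1ℚ - ¼))) (fromℕ-* N w) (expectOnline-after correct) ⟩
    ½ * (fromℕ N * fromℕ w) * (E success - (1ℚ - ¼))
      ≤⟨ *-monoˡ-≤ (0≤* 0≤½ (0≤* (0≤fromℕ N) (0≤fromℕ w)))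
           (≤-by ((1ℚ - ¼) + D - E success) (p≤q⇒0≤q-p success-needs-touching) (lemma₁ (E success) (1ℚ - ¼) D)) ⟩
    ½ * (fromℕ N * fromℕ w) * D
      ≡⟨ lemma₂ (fromℕ N) (fromℕ w) (p {w}) (sum (E ∘ τ)) ⟩
    fromℕ N * p {w} * (half * sum (E ∘ τ))
      ≡⟨ trans (cong (_* (half * sum (E ∘ τ))) (fromℕ-recip N)) (*-identityˡ (half * sum (E ∘ τ))) ⟩
    half * sum (E ∘ τ)
      ≤⟨ expected-cost ⟩
    expectOnline A totalCost t ∎
    where
    open ≤-Reasoning
    D = p {w} * sum (E ∘ τ)
    lemma₁ : ∀ s k d → s - k + (k + d - s) ≡ d
    lemma₁ = solve-∀ ℚ-ring
    lemma₂ : ∀ n w p s → ½ * (n * w) * (p * s) ≡ n * p * (½ * w * s)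
    lemma₂ = solve-∀ ℚ-ring

online-lower-bound : ∀ ε₀ → ε₀ < ¼ → ∀ w → 1 ℕ.≤ w → (A : OnlineAlgorithm w) → OnlineError ε₀ A →
  ¼ * (¼ - ε₀) * fromℕ (2 ℕ.^ w ℕ.* w) ≤sup expectOnline A totalCost
online-lower-bound ε₀ ε₀<¼ w 1≤w A succeeds b b<bound = t , ≤-trans (<⇒≤ b<bound) (≤-trans (begin
  ¼ * η * M
    ≡⟨ lemma₁ η M ⟩
  ½ * M * (½ * η)
    ≡⟨ cong (½ * M *_) (lemma₂ ε₀) ⟩
  ½ * M * (1ℚ - ε₀ - ½ * η - (1ℚ - ¼))
    ≤⟨ *-monoˡ-≤ (0≤* 0≤½ (0≤fromℕ (2 ℕ.^ w ℕ.* w))) (+-monoˡ-≤ (- (1ℚ - ¼)) correct≥) ⟩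
  ½ * M * (expectOnline A correct t - (1ℚ - ¼)) ∎) (Online.online-bound 1≤w A t))
  where
  open ≤-Reasoning
  η = ¼ - ε₀
  M = fromℕ (2 ℕ.^ w ℕ.* w)
  0<½η : 0ℚ < ½ * η
  0<½η = subst (_< ½ * η) (*-zeroʳ ½) (*-monoʳ-<-pos ½ (p<q⇒0<q-p ε₀<¼))
  threshold< : 1ℚ - ε₀ - ½ * η < 1ℚ - ε₀
  threshold< = subst (1ℚ - ε₀ - ½ * η <_) (+-identityʳ (1ℚ - ε₀)) (+-monoʳ-< (1ℚ - ε₀) (neg-antimono-< 0<½η))
  -- The success probability is a supremum, so a time is available only for thresholds strictly
  -- below it. Half of the gap `η` is given up for this; the other half, times the 1/2 of
  -- `online-bound`, is the constant `¼ * η`.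
  t = proj₁ (succeeds (1ℚ - ε₀ - ½ * η) threshold<)
  correct≥ = proj₂ (succeeds (1ℚ - ε₀ - ½ * η) threshold<)
  lemma₁ : ∀ η M → ¼ * η * M ≡ ½ * M * (½ * η)
  lemma₁ = solve-∀ ℚ-ring
  lemma₂ : ∀ ε → ½ * (¼ - ε) ≡ 1ℚ - ε - ½ * (¼ - ε) - (1ℚ - ¼)
  lemma₂ = solve-∀ ℚ-ring

-- Decision trees as offline strategies

data Tree (w : ℕ) : Set where
  leaf : Bool → Tree w
  node : Fin (2 ℕ.^ w) → Fin w → (Bool → Tree w) → Tree w

module _ {w : ℕ} where

  act : Tree w → Action (Query w)
  act (leaf b)     = halt b
  act (node i j f) = move (query i j)

  feed : Observation → Tree w → Tree w
  feed (response (just b)) (node i j f) = f b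
  -- Coins, silent responses and responses at a leaf never occur when a tree is run; this clause
  -- makes `feed` total.
  feed _                   T            = T

  -- A history has its latest observation first, so `foldr` feeds the oldest one first and ends at
  -- the current node.
  strategy : Tree w → Strategy (Query w)
  strategy T h = act (foldr feed T h)

  eval : Tree w → Input w → Bool
  eval (leaf b)     x = b
  eval (node i j f) x = eval (f (entry x i j)) x

  treeCost : Tree w → Input w → Costs w → ℚ
  treeCost (leaf b)     x c = 0ℚ
  treeCost (node i j f) x c = fromℕ (entry c i j) + treeCost (f (entry x i j)) x c

  -- Halting is itself an action: with no action left, `run` reports `nothing` even at a leaf, hence
  -- the `suc t` there.
  data HaltsBefore : ℕ → Tree w → Set where
    leaf : ∀ {t b} → HaltsBefore (suc t) (leaf b)
    node : ∀ {t i j f} → (∀ b → HaltsBefore t (f b)) → HaltsBefore (suc t) (node i j f)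

  module _ (next : Query w → Payments w → Payments w) (answer : Query w → Bool)
    (T₀ : Tree w) (g : Payments w → Maybe Bool → ℚ) where

    private
      step : Step w (Query w)
      step m θ = next m θ , just (answer m)

    run-tree-≤ : (V : Tree w → Payments w → ℚ) (Inv : Payments w → Set) →
      (∀ m θ → Inv θ → Inv (next m θ)) →
      (∀ T θ o → Inv θ → g θ o ≤ V T θ) →
      (∀ i j f θ → Inv θ → V (f (answer (query i j))) (next (query i j) θ) ≤ V (node i j f) θ) →
      ∀ t h θ → Inv θ → run step (strategy T₀) g t h θ ≤ V (foldr feed T₀ h) θ
    run-tree-≤ V Inv preserved stop pay = go
      where
      go : ∀ t h θ → Inv θ → run step (strategy T₀) g t h θ ≤ V (foldr feed T₀ h) θ
      go zero    h θ inv = stop (foldr feed T₀ h) θ nothing inv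
      go (suc t) h θ inv with foldr feed T₀ h in eq
      ... | leaf b     = stop (leaf b) θ (just b) inv
      ... | node i j f = ≤-trans
        (subst (λ T → run step (strategy T₀) g t h′ θ′ ≤ V T θ′) (cong (feed _) eq) (go t h′ θ′ (preserved (query i j) θ inv)))
        (pay i j f θ inv)
        where
        θ′ = next (query i j) θ
        h′ = response (just (answer (query i j))) ∷ h

    run-tree-output : ∀ {k} (out : Tree w → Bool) →
      (∀ b → out (leaf b) ≡ b) → (∀ i j f → out (node i j f) ≡ out (f (answer (query i j)))) →
      (∀ θ b → out T₀ ≡ b → g θ (just b) ≡ k) →
      ∀ t h θ → HaltsBefore t (foldr feed T₀ h) → out (foldr feed T₀ h) ≡ out T₀ →
      run step (strategy T₀) g t h θ ≡ k
    run-tree-output out out-leaf out-node result = go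
      where
      go : ∀ t h θ → HaltsBefore t (foldr feed T₀ h) → out (foldr feed T₀ h) ≡ out T₀ →
        run step (strategy T₀) g t h θ ≡ _
      go (suc t) h θ before same with foldr feed T₀ h in eq
      go (suc t) h θ leaf          same | leaf b     = result θ b (trans (sym same) (out-leaf b))
      go (suc t) h θ (node before) same | node i j f = go t h′ (next (query i j) θ)
        (subst (HaltsBefore t) (sym now) (before b)) (trans (cong out now) (trans (sym (out-node i j f)) same))
        where
        b = answer (query i j)
        h′ = response (just b) ∷ h
        now : foldr feed T₀ h′ ≡ f b
        now = cong (feed (response (just b))) eq

  0≤treeCost : ∀ T x c → 0ℚ ≤ treeCost T x c
  0≤treeCost (leaf b)     x c = ≤-refl
  0≤treeCost (node i j f) x c = 0≤+ (0≤fromℕ (entry c i j)) (0≤treeCost (f (entry x i j)) x c)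

  private
    pay : Costs w → Query w → Payments w → Payments w
    pay c (query i j) θ = modify {w} θ i j λ _ → fromℕ (entry c i j)

    NonNeg : Payments w → Set
    NonNeg θ = ∀ i j → 0ℚ ≤ θ i j

  pay-nonNeg : ∀ c m θ → NonNeg θ → NonNeg (pay c m θ)
  pay-nonNeg c (query i j) θ 0≤θ i′ j′ with i′ Fin.≟ i
  ... | no i′≢i = subst (λ row → 0ℚ ≤ row j′) (sym (updateAt-minimal i′ i θ i′≢i)) (0≤θ i′ j′)
  ... | yes refl = subst (λ row → 0ℚ ≤ row j′) (sym (updateAt-updates i θ)) (in-row (j′ Fin.≟ j))
    where
    in-row : Dec (j′ ≡ j) → 0ℚ ≤ updateAt (θ i) j (λ _ → fromℕ (entry c i j)) j′
    in-row (yes refl) = subst (0ℚ ≤_) (sym (updateAt-updates j (θ i))) (0≤fromℕ (entry c i j))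
    in-row (no j′≢j)  = subst (0ℚ ≤_) (sym (updateAt-minimal j′ j (θ i) j′≢j)) (0≤θ i j′)

  sum-overwrite≤ : ∀ {n} (v : Fin n → ℚ) j k → 0ℚ ≤ v j → sum (updateAt v j λ _ → k) ≤ sum v + k
  sum-overwrite≤ v j k 0≤vj = ≤-by (v j) 0≤vj (sum-updateAt v j λ _ → k)

  norm-pay : ∀ {m} (θ : Fin m → Fin w → ℚ) i j k → 0ℚ ≤ θ i j →
    sum (λ i′ → sum (updateAt θ i (λ row → updateAt row j λ _ → k) i′)) ≤ sum (λ i′ → sum (θ i′)) + k
  norm-pay {suc m} θ zero j k 0≤θ = begin
    sum (updateAt (θ zero) j λ _ → k) + R  ≤⟨ +-monoˡ-≤ R (sum-overwrite≤ (θ zero) j k 0≤θ) ⟩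
    sum (θ zero) + k + R                   ≡⟨ lemma (sum (θ zero)) k R ⟩
    sum (θ zero) + R + k                   ∎
    where
    open ≤-Reasoning
    R = sum λ i → sum (θ (suc i))
    lemma : ∀ a b c → a + b + c ≡ a + c + b
    lemma = solve-∀ ℚ-ring
  norm-pay {suc m} θ (suc i) j k 0≤θ = ≤-trans (+-monoʳ-≤ (sum (θ zero)) (norm-pay (θ ∘ suc) i j k 0≤θ))
    (≤-reflexive (sym (+-assoc (sum (θ zero)) (sum λ i → sum (θ (suc i))) k)))

  -- The potential is the payments made plus the cost of the remaining path. Equality may fail
  -- because the run can be cut off at `t`, and because `treeCost` counts a repeated query again.
  run-tree-cost : ∀ x c T t → run (offlineStep x c) (strategy T) (totalCost x) t [] unpaid ≤ treeCost T x c
  run-tree-cost x c T t = ≤-trans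
    (run-tree-≤ (pay c) (λ (query i j) → entry x i j) T (totalCost x)
      (λ T θ → ‖_‖₁ {w} θ + treeCost T x c) NonNeg (pay-nonNeg c)
      (λ T θ _ _ → ≤-by (treeCost T x c) (0≤treeCost T x c) refl)
      (λ i j f θ 0≤θ → ≤-trans
        (+-monoˡ-≤ (treeCost (f (entry x i j)) x c) (norm-pay θ i j (fromℕ (entry c i j)) (0≤θ i j)))
        (≤-reflexive (+-assoc (‖_‖₁ {w} θ) (fromℕ (entry c i j)) (treeCost (f (entry x i j)) x c))))
      t [] unpaid (λ _ _ → ≤-refl))
    (≤-reflexive (trans (cong (_+ treeCost T x c) norm-unpaid) (+-identityˡ (treeCost T x c))))
    where
    sum-zero : ∀ n → sum {n} (λ _ → 0ℚ) ≡ 0ℚ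
    sum-zero n = trans (sum-const n 0ℚ) (*-zeroʳ (fromℕ n))
    norm-unpaid : ‖_‖₁ {w} unpaid ≡ 0ℚ
    norm-unpaid = trans (sum-cong-≗ {2 ℕ.^ w} λ _ → sum-zero w) (sum-zero (2 ℕ.^ w))

  run-tree-correct : ∀ x c T t → HaltsBefore t T → eval T x ≡ tribes x →
    run (offlineStep x c) (strategy T) (correct x) t [] unpaid ≡ 1ℚ
  run-tree-correct x c T t before right =
    run-tree-output (pay c) (λ (query i j) → entry x i j) T (correct x) (λ T → eval T x) (λ _ → refl) (λ _ _ _ → refl)
      (λ θ b eq → indicator-yes (≡-dec Bool._≟_ (just b) (just (tribes x))) (cong just (trans (sym eq) right)))
      t [] unpaid before refl

  haltsBefore-mono : ∀ {s t T} → s ℕ.≤ t → HaltsBefore s T → HaltsBefore t T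
  haltsBefore-mono (s≤s s≤t) leaf     = leaf
  haltsBefore-mono (s≤s s≤t) (node f) = node λ b → haltsBefore-mono s≤t (f b)

-- Queries in order of increasing cost

module _ {w : ℕ} where

  -- Scans the costs from `k` to `k + m - 1`. For a permutation, every cost from 1 to w is found by
  -- `permutation-surjective`; the `no` branch makes the definition total on arbitrary cost vectors.
  order : Vec ℕ w → ℕ → ℕ → List (Fin w)
  order r zero    k = []
  order r (suc m) k with Fin.any? (λ j → lookup r j ℕ.≟ k)
  ... | yes (j , _) = j ∷ order r m (suc k)
  ... | no _        = order r m (suc k)

  order-length : ∀ r m k → length (order r m k) ℕ.≤ m
  order-length r zero    k = z≤n
  order-length r (suc m) k with Fin.any? (λ j → lookup r j ℕ.≟ k)
  ... | yes _ = s≤s (order-length r m (suc k))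
  ... | no _  = ℕ.m≤n⇒m≤1+n (order-length r m (suc k))

  order-≥ : ∀ r m k → All (λ j → k ℕ.≤ lookup r j) (order r m k)
  order-≥ r zero    k = []
  order-≥ r (suc m) k with Fin.any? (λ j → lookup r j ℕ.≟ k)
  ... | yes (j , eq) = ℕ.≤-reflexive (sym eq) ∷ All.map (ℕ.≤-trans (ℕ.n≤1+n k)) (order-≥ r m (suc k))
  ... | no _         = All.map (ℕ.≤-trans (ℕ.n≤1+n k)) (order-≥ r m (suc k))

  lookup-injective : ∀ {r} → r ∈ permutations w → ∀ {i j} → lookup r i ≡ lookup r j → i ≡ j
  lookup-injective r∈P {i} {j} = Unique.lookup-injective (permutation-distinct r∈P) i j

  order-∈ : ∀ {r} → r ∈ permutations w → ∀ m k j → k ℕ.≤ lookup r j → lookup r j ℕ.< k ℕ.+ m → j ∈ order r m k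
  order-∈ {r} r∈P zero    k j k≤ <k = ⊥-elim (ℕ.<-irrefl refl (ℕ.≤-<-trans k≤ (subst (lookup r j ℕ.<_) (ℕ.+-identityʳ k) <k)))
  order-∈ {r} r∈P (suc m) k j k≤ <k+m with Fin.any? (λ j → lookup r j ℕ.≟ k) | lookup r j ℕ.≟ k
  ... | yes (j′ , eq′) | yes eq = here (lookup-injective r∈P (trans eq (sym eq′)))
  ... | no ∄           | yes eq = ⊥-elim (∄ (j , eq))
  ... | yes _          | no neq = there (order-∈ r∈P m (suc k) j (ℕ.≤∧≢⇒< k≤ (neq ∘ sym)) (subst (lookup r j ℕ.<_) (ℕ.+-suc k m) <k+m))
  ... | no _           | no neq = order-∈ r∈P m (suc k) j (ℕ.≤∧≢⇒< k≤ (neq ∘ sym)) (subst (lookup r j ℕ.<_) (ℕ.+-suc k m) <k+m)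

  conj : Vec Bool w → List (Fin w) → Bool
  conj y []       = true
  conj y (j ∷ js) = lookup y j ∧ conj y js

  listCost : Vec ℕ w → Vec Bool w → List (Fin w) → ℚ
  listCost r y []       = 0ℚ
  listCost r y (j ∷ js) = fromℕ (lookup r j) + ⟦ lookup y j ⟧ * listCost r y js

-- Pigeonhole: if a cost were missing, punching it out would inject the w variables into w - 1
-- values.
permutation-surjective : ∀ {w r} → r ∈ permutations w → ∀ k → k ℕ.< w → ∃[ j ] lookup r j ≡ suc k
permutation-surjective {suc v} {r} r∈P k k<w with Fin.any? (λ j → lookup r j ℕ.≟ suc k)
... | yes found = found
... | no ∄ = ⊥-elim (ℕ.1+n≰n (Fin.injective⇒≤ {f = f} λ {i} {j} eq → lookup-injective r∈P
        (trans (cost i) (trans (cong suc (Fin.fromℕ<-injective (index i) (index j) (index< i) (index< j)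
          (Fin.punchOut-injective (avoids i) (avoids j) eq))) (sym (cost j))))))
  where
  index : Fin (suc v) → ℕ
  index j = proj₁ (∈-applyUpTo⁻ suc (permutation-costs r∈P j))
  index< : ∀ j → index j ℕ.< suc v
  index< j = proj₁ (proj₂ (∈-applyUpTo⁻ suc (permutation-costs r∈P j)))
  cost : ∀ j → lookup r j ≡ suc (index j)
  cost j = proj₂ (proj₂ (∈-applyUpTo⁻ suc (permutation-costs r∈P j)))
  avoids : ∀ j → Fin.fromℕ< k<w ≢ Fin.fromℕ< (index< j)
  avoids j eq = ∄ (j , trans (cost j) (cong suc (sym (Fin.fromℕ<-injective k (index j) k<w (index< j) eq))))
  f : Fin (suc v) → Fin v
  f j = Fin.punchOut (avoids j)

all-lookup : ∀ {n} (y : Vec Bool n) → all y ≡ true → ∀ j → lookup y j ≡ true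
all-lookup (true ∷ y) eq zero    = refl
all-lookup (true ∷ y) eq (suc j) = all-lookup y eq j

lookup-all : ∀ {n} (y : Vec Bool n) → (∀ j → lookup y j ≡ true) → all y ≡ true
lookup-all []      _  = refl
lookup-all (b ∷ y) eq = cong₂ _∧_ (eq zero) (lookup-all y (eq ∘ suc))

≡-from-true : ∀ {a b : Bool} → (a ≡ true → b ≡ true) → (b ≡ true → a ≡ true) → a ≡ b
≡-from-true {true}  {true}  _ _ = refl
≡-from-true {true}  {false} f _ = sym (f refl)
≡-from-true {false} {true}  _ g = g refl
≡-from-true {false} {false} _ _ = refl

module _ {w : ℕ} where

  conj-lookup : ∀ (y : Vec Bool w) js → conj y js ≡ true → ∀ {j} → j ∈ js → lookup y j ≡ true
  conj-lookup y (i ∷ js) eq j∈ with lookup y i in eqᵢ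
  conj-lookup y (i ∷ js) eq (here refl) | true = eqᵢ
  conj-lookup y (i ∷ js) eq (there j∈)  | true = conj-lookup y js eq j∈

  lookup-conj : ∀ (y : Vec Bool w) js → (∀ j → lookup y j ≡ true) → conj y js ≡ true
  lookup-conj y []       _  = refl
  lookup-conj y (j ∷ js) eq = cong₂ _∧_ (eq j) (lookup-conj y js eq)

  conj-all : ∀ (y : Vec Bool w) js → (∀ j → j ∈ js) → conj y js ≡ all y
  conj-all y js complete = ≡-from-true (λ eq → lookup-all y λ j → conj-lookup y js eq (complete j))
    (λ eq → lookup-conj y js (all-lookup y eq))

  order-complete : ∀ {r} → r ∈ permutations w → ∀ j → j ∈ order r w 1
  order-complete {r} r∈P j with n , n<w , eq ← ∈-applyUpTo⁻ suc (permutation-costs r∈P j) =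
    order-∈ r∈P w 1 j (subst (1 ℕ.≤_) (sym eq) (s≤s z≤n)) (subst (ℕ._< suc w) (sym eq) (s≤s n<w))

  listCost-update : ∀ r (y : Vec Bool w) j b js → All (λ j′ → j′ ≢ j) js → listCost r (y Vec.[ j ]≔ b) js ≡ listCost r y js
  listCost-update r y j b []        []           = refl
  listCost-update r y j b (j′ ∷ js) (j′≢j ∷ ≢j) = cong₂ (λ b c → fromℕ (lookup r j′) + ⟦ b ⟧ * c)
    (lookup∘updateAt′ j′ j j′≢j y) (listCost-update r y j b js ≢j)

  fair-bit : ∀ {n} j (F : Vec Bool n → ℚ) → (∀ y b → F (y Vec.[ j ]≔ b) ≡ F y) →
    uniform (tuples bits n) (λ y → ⟦ lookup y j ⟧ * F y) ≡ ½ * uniform (tuples bits n) F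
  fair-bit {n} j F invariant = begin
    uniform (tuples bits n) (λ y → ⟦ lookup y j ⟧ * F y)
      ≡⟨ resample bits true∈bits j (λ y → ⟦ lookup y j ⟧ * F y) ⟩
    uniform (tuples bits n) (λ y → uniform bits λ b → ⟦ lookup (y Vec.[ j ]≔ b) j ⟧ * F (y Vec.[ j ]≔ b))
      ≡⟨ uniform-cong (tuples bits n) (λ y → trans
           (uniform-cong bits λ b → cong₂ (λ b q → ⟦ b ⟧ * q) (lookup∘updateAt j {λ _ → b} y) (invariant y b))
           (trans (uniform-bits (λ b → ⟦ b ⟧ * F y)) (lemma (F y)))) ⟩
    uniform (tuples bits n) (λ y → ½ * F y)
      ≡⟨ uniform-*ˡ (tuples bits n) ½ F ⟩
    ½ * uniform (tuples bits n) F ∎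
    where
    open ≡-Reasoning
    lemma : ∀ a → ½ * (1ℚ * a + 0ℚ * a) ≡ ½ * a
    lemma = solve-∀ ℚ-ring

  2ℚ : ℚ
  2ℚ = 1ℚ + 1ℚ

  -- With `k` costs already tried, the next cost is `suc k`. The bound solves the recursion a(k) = k
  -- + a(k + 1)/2 exactly; slack arises only at the end of the list, where nothing remains to be
  -- paid.
  expected-listCost : ∀ {r} → r ∈ permutations w → ∀ m k → k ℕ.+ m ≡ w →
    uniform rows (λ y → listCost r y (order r m (suc k))) ≤ 2ℚ * fromℕ (suc k) + 2ℚ
  expected-listCost {r} r∈P zero    k _ = ≤-trans (≤-reflexive (uniform-0 (rows {w})))
    (0≤+ (0≤* (nonNegative⁻¹ 2ℚ) (0≤fromℕ (suc k))) (nonNegative⁻¹ 2ℚ))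
  expected-listCost {r} r∈P (suc m) k k+m≡w with Fin.any? (λ j → lookup r j ℕ.≟ suc k)
  ... | no ∄ = ⊥-elim (∄ (permutation-surjective r∈P k (subst (k ℕ.<_) k+m≡w (ℕ.m<m+n k (s≤s z≤n)))))
  ... | yes (j , eq) = begin
    E (λ y → fromℕ (lookup r j) + ⟦ lookup y j ⟧ * L y)
      ≡⟨ uniform-+ (rows {w}) (λ _ → fromℕ (lookup r j)) (λ y → ⟦ lookup y j ⟧ * L y) ⟩
    E (λ _ → fromℕ (lookup r j)) + E (λ y → ⟦ lookup y j ⟧ * L y)
      -- The variables still listed have larger costs and so differ from `j`: whether the search
      -- goes on is a fair coin independent of what it would cost.
      ≡⟨ cong₂ _+_ (trans (uniform-const (row₀∈rows {w}) (fromℕ (lookup r j))) (cong fromℕ eq))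
           (fair-bit j L λ y b → listCost-update r y j b js fresh) ⟩
    fromℕ (suc k) + ½ * E L
      ≤⟨ +-monoʳ-≤ (fromℕ (suc k)) (*-monoˡ-≤ 0≤½ (expected-listCost r∈P m (suc k) (trans (sym (ℕ.+-suc k m)) k+m≡w))) ⟩
    fromℕ (suc k) + ½ * (2ℚ * fromℕ (suc (suc k)) + 2ℚ)
      ≡⟨ cong (λ q → fromℕ (suc k) + ½ * (2ℚ * q + 2ℚ)) (fromℕ-suc (suc k)) ⟩
    fromℕ (suc k) + ½ * (2ℚ * (1ℚ + fromℕ (suc k)) + 2ℚ)
      ≡⟨ lemma (fromℕ (suc k)) ⟩
    2ℚ * fromℕ (suc k) + 2ℚ ∎
    where
    open ≤-Reasoning
    js = order r m (suc (suc k))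
    E : (Vec Bool w → ℚ) → ℚ
    E = uniform rows
    L : Vec Bool w → ℚ
    L y = listCost r y js
    fresh : All (λ j′ → j′ ≢ j) js
    fresh = All.map (λ k< eq′ → ℕ.<-irrefl (trans (sym eq) (cong (lookup r) (sym eq′))) k<) (order-≥ r m (suc (suc k)))
    lemma : ∀ a → a + ½ * ((1ℚ + 1ℚ) * (1ℚ + a) + (1ℚ + 1ℚ)) ≡ (1ℚ + 1ℚ) * a + (1ℚ + 1ℚ)
    lemma = solve-∀ ℚ-ring

  -- The cheapest-first search tree

  visit : Fin (2 ℕ.^ w) → List (Fin w) → Tree w → Tree w
  visit i []       rest = leaf true
  visit i (j ∷ js) rest = node i j λ b → if b then visit i js rest else rest

  eval-visit : ∀ i js rest x → eval (visit i js rest) x ≡ conj (lookup x i) js ∨ eval rest x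
  eval-visit i []       rest x = refl
  eval-visit i (j ∷ js) rest x with entry x i j
  ... | true  = eval-visit i js rest x
  ... | false = refl

  -- An inequality only because a satisfied tribe ends the search and saves the cost of `rest`.
  -- Charging `rest` regardless makes the bound a sum of separate terms for the tribes.
  treeCost-visit : ∀ i js rest x c →
    treeCost (visit i js rest) x c ≤ listCost (lookup c i) (lookup x i) js + treeCost rest x c
  treeCost-visit i []       rest x c = ≤-trans (0≤treeCost rest x c) (≤-reflexive (sym (+-identityˡ (treeCost rest x c))))
  treeCost-visit i (j ∷ js) rest x c = cases (entry x i j)
    where
    a = fromℕ (entry c i j)
    l = listCost (lookup c i) (lookup x i) js
    R = treeCost rest x c
    lemma₁ : ∀ a l R → a + (l + R) ≡ a + 1ℚ * l + R
    lemma₁ = solve-∀ ℚ-ring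
    lemma₂ : ∀ a l R → a + R ≡ a + 0ℚ * l + R
    lemma₂ = solve-∀ ℚ-ring
    cases : ∀ b → a + treeCost (if b then visit i js rest else rest) x c ≤ a + ⟦ b ⟧ * l + R
    cases true  = ≤-trans (+-monoʳ-≤ a (treeCost-visit i js rest x c)) (≤-reflexive (lemma₁ a l R))
    cases false = ≤-reflexive (lemma₂ a l R)

  visit-halts : ∀ i js {rest t} → HaltsBefore (suc t) rest → HaltsBefore (length js ℕ.+ suc t) (visit i js rest)
  visit-halts i []       {rest} before = leaf
  visit-halts i (j ∷ js) {rest} {t} before = node λ where
    true  → visit-halts i js before
    false → haltsBefore-mono (ℕ.m≤n+m (suc t) (length js)) before

  module _ (c : Costs w) where

    cheapestFirst : Fin (2 ℕ.^ w) → List (Fin w)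
    cheapestFirst i = order (lookup c i) w 1

    -- The recursion is on the number of tribes left, and `e` places them among all 2^w tribes; the
    -- whole search has `e = id`.
    search : ∀ n → (Fin n → Fin (2 ℕ.^ w)) → Tree w
    search zero    e = leaf false
    search (suc n) e = visit (e zero) (cheapestFirst (e zero)) (search n (e ∘ suc))

    -- At most `w` queries per tribe, and one action to halt.
    search-halts : ∀ n e → HaltsBefore (suc (n ℕ.* w)) (search n e)
    search-halts zero    e = leaf
    search-halts (suc n) e = haltsBefore-mono
      (ℕ.≤-trans (ℕ.+-monoˡ-≤ (suc (n ℕ.* w)) (order-length (lookup c (e zero)) w 1)) (ℕ.≤-reflexive (ℕ.+-suc w (n ℕ.* w))))
      (visit-halts (e zero) (cheapestFirst (e zero)) (search-halts n (e ∘ suc)))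

    treeCost-search : ∀ n e x → treeCost (search n e) x c ≤
      sum λ i → listCost (lookup c (e i)) (lookup x (e i)) (cheapestFirst (e i))
    treeCost-search zero    e x = ≤-refl
    treeCost-search (suc n) e x = ≤-trans (treeCost-visit (e zero) (cheapestFirst (e zero)) (search n (e ∘ suc)) x c)
      (+-monoʳ-≤ (listCost (lookup c (e zero)) (lookup x (e zero)) (cheapestFirst (e zero))) (treeCost-search n (e ∘ suc) x))

    -- The vector `y` is the part of `x` seen through `e`, so that it can shrink in the induction
    -- while `x` keeps all its tribes.
    eval-search : (∀ i → lookup c i ∈ permutations w) → ∀ n e x (y : Vec (Vec Bool w) n) →
      (∀ i → lookup x (e i) ≡ lookup y i) → eval (search n e) x ≡ satisfied y
    eval-search c∈ zero    e x []      _  = refl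
    eval-search c∈ (suc n) e x (r ∷ y) eq = trans (eval-visit (e zero) (cheapestFirst (e zero)) (search n (e ∘ suc)) x)
      (cong₂ _∨_ (trans (conj-all (lookup x (e zero)) (cheapestFirst (e zero)) (order-complete (c∈ (e zero)))) (cong all (eq zero)))
        (eval-search c∈ n (e ∘ suc) x y (eq ∘ suc)))

-- The offline upper bound

module Offline (w : ℕ) where

  open Instance w

  algorithm : OfflineAlgorithm w
  algorithm c = strategy (search c N id)

  expectOffline-≡ : ∀ g t → expectOffline algorithm g t ≡
    uniform inputs λ x → uniform costVectors λ c → run (offlineStep x c) (algorithm c) (g x) t [] unpaid
  expectOffline-≡ g t = uniform-cartesianProductWith _,_ inputs costVectors _

  algorithm-correct : OfflineError 0ℚ algorithm
  algorithm-correct q q<1 = suc (N ℕ.* w) , ≤-trans (<⇒≤ q<1)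
    (subst (1ℚ ≤_) (sym (expectOffline-≡ correct (suc (N ℕ.* w))))
      (const-≤-uniform input₀∈ λ x _ → const-≤-uniform costs₀∈ λ c c∈ → ≤-reflexive (sym
        (run-tree-correct x c (search c N id) (suc (N ℕ.* w)) (search-halts c N id)
          (eval-search c (tuples-lookup P N c∈) N id x x λ _ → refl)))))

  algorithm-cost : expectOffline algorithm totalCost sup≤ (+ 4 / 1 * fromℕ N)
  algorithm-cost t = begin
    expectOffline algorithm totalCost t
      ≡⟨ expectOffline-≡ totalCost t ⟩
    uniform inputs (λ x → uniform costVectors λ c → run (offlineStep x c) (algorithm c) (totalCost x) t [] unpaid)
      ≤⟨ uniform-mono inputs (λ x _ → uniform-mono costVectors λ c _ →
           ≤-trans (run-tree-cost x c (search c N id) t) (treeCost-search c N id x)) ⟩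
    uniform inputs (λ x → uniform costVectors λ c → sum λ i → L c i (lookup x i))
      -- The order of the queries depends on the costs, so these are fixed first and the input is
      -- averaged with the order known.
      ≡⟨ uniform-swap inputs costVectors (λ x c → sum λ i → L c i (lookup x i)) ⟩
    uniform costVectors (λ c → uniform inputs λ x → sum λ i → L c i (lookup x i))
      ≡⟨ uniform-cong costVectors (λ c → trans (uniform-sum inputs λ x i → L c i (lookup x i))
           (sum-cong-≗ λ i → uniform-lookup rows row₀∈rows i (L c i))) ⟩
    uniform costVectors (λ c → sum λ i → uniform rows (L c i))
      -- No cost has been tried yet, so the bound is taken at `k = 0`, where it reads 2 * 1 + 2 = 4.
      ≤⟨ uniform-≤-const costs₀∈ (λ c c∈ → ≤-trans
           (sum-mono λ i → expected-listCost (tuples-lookup P N c∈ i) w 0 refl)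
           (≤-reflexive (trans (sum-const N (+ 4 / 1)) (*-comm (fromℕ N) (+ 4 / 1))))) ⟩
    + 4 / 1 * fromℕ N ∎
    where
    open ≤-Reasoning
    L : Costs w → Fin N → Vec Bool w → ℚ
    L c i y = listCost (lookup c i) y (cheapestFirst c i)

offline-upper-bound : ∀ w → opt≤ 0ℚ w (+ 4 / 1 * fromℕ (2 ℕ.^ w))
offline-upper-bound w B B> = Offline.algorithm w , Offline.algorithm-correct w ,
  λ t → ≤-trans (Offline.algorithm-cost w t) (<⇒≤ B>)

mainTheorem12 : (ε₀ : ℚ) → 0ℚ ≤ ε₀ → ε₀ < + 1 / 4 →
    (∃[ C ] ((w : ℕ) → 1 ℕ.≤ w → opt≤ 0ℚ w (C * fromℕ (2 ℕ.^ w))))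
    × (∃[ c ] (0ℚ < c × ((w : ℕ) → 1 ℕ.≤ w → (A : OnlineAlgorithm w) →
    OnlineError ε₀ A →
    c * fromℕ (2 ℕ.^ w ℕ.* w) ≤sup expectOnline A totalCost)))
mainTheorem12 ε₀ _ ε₀<¼ =
  (+ 4 / 1 , λ w _ → offline-upper-bound w) ,
  ¼ * (¼ - ε₀) , 0<c , online-lower-bound ε₀ ε₀<¼
  where
  0<c : 0ℚ < ¼ * (¼ - ε₀)
  0<c = subst (_< ¼ * (¼ - ε₀)) (*-zeroʳ ¼) (*-monoʳ-<-pos ¼ (p<q⇒0<q-p ε₀<¼))
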